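{- Let $G$ be a nontrivial connected graph of order $n$. Then $spvc(G)=n-3$ if and only if $G$ is isomorphic to one of the following twelve graphs: (1) the triangle $K_3$; (2) the star $K_{1,3}$; (3) the cycle $C_4$; (4) the graph obtained from a triangle by attaching one pendant vertex to one of its vertices; (5) $K_4$ minus an edge; (6) the path $P_5$ on five vertices; (7) the tree obtained from $K_{1,3}$ by subdividing one edge once; (8) the graph obtained from a triangle by attaching one pendant vertex to each of two of its vertices; (9) the graph obtained from a triangle by joining one of its vertices by an edge to an end-vertex of a disjoint path on two vertices; (10) the graph obtained from $C_4$ by attaching one pendant vertex to one of its vertices; (11) the graph obtained from $K_4$ minus an edge by attaching one pendant vertex to one of its vertices of degree $2$; (12) the graph of order $6$ obtained from a triangle by attaching one pendant vertex to each of its three vertices.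
   Context: All graphs are simple, finite and undirected; nontrivial means having at least two vertices; the order of a graph is its number of vertices. Attaching a pendant vertex to a vertex $x$ means adding a new vertex adjacent only to $x$. Vertex-colorings are arbitrary (adjacent vertices may receive the same color). A path in a vertex-colored graph is a vertex-proper path if any two adjacent internal vertices of the path differ in color (the end-vertices are not internal). A $u$-$v$ geodesic is a $u$-$v$ path of length $d(u,v)$. A vertex-colored graph is strong proper vertex-connected if for any two distinct vertices $u,v$ there exists a vertex-proper $u$-$v$ geodesic. For a connected graph $G$, $spvc(G)$ is the smallest number of colors required to make $G$ strong proper vertex-connected. The value $0$ is allowed: it means that no vertex needs to be colored, where an uncolored path counts as vertex-proper exactly when it has no internal vertices. -}

module Defs where

open import Data.Empty using (⊥)
open import Data.Fin using (Fin; zero; suc; toℕ; splitAt; #_)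
open import Data.Fin.Properties using () renaming (_≟_ to _≟ᶠ_)
open import Data.List using (List; []; _∷_)
open import Data.List.Relation.Unary.Linked using (Linked)
open import Data.List.Relation.Unary.Unique.Propositional using (Unique)
open import Data.Nat using (ℕ; zero; suc; _+_; _≤_; _%_; NonZero)
open import Data.Nat.Properties using () renaming (_≟_ to _≟ⁿ_)
open import Data.Product using (Σ-syntax; ∃-syntax; _×_; _,_; proj₁)
open import Data.Sum using (_⊎_; inj₁; inj₂; swap)
open import Function using (_⇔_; _⤖_; Bijection)
open import Level using (0ℓ)
open import Relation.Binary using (Rel; Symmetric; Decidable)
open import Relation.Binary.Construct.Closure.ReflexiveTransitive
  using (Star; ε; _◅_)
open import Relation.Binary.PropositionalEquality
  using (_≡_; _≢_; refl; sym)
open import Relation.Nullary using (¬_; no)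
open import Relation.Nullary.Decidable using (_×-dec_; _⊎-dec_; ¬?)
import Relation.Unary as U

record Graph (n : ℕ) : Set₁ where
  infix 4 _~_ _~?_
  field
    _~_     : Rel (Fin n) 0ℓ
    ~-sym   : Symmetric _~_
    ~-irr   : ∀ v → ¬ (v ~ v)
    _~?_    : Decidable _~_

infix 4 _≅_

record _≅_ {m n : ℕ} (G : Graph m) (H : Graph n) : Set where
  private
    module G = Graph G
    module H = Graph H
  field
    bijection : Fin m ⤖ Fin n
  open Bijection bijection using (to)
  field
    preserves : ∀ u v → (u G.~ v) ⇔ (to u H.~ to v)

IsLeast : (ℕ → Set) → ℕ → Set
IsLeast P m = P m × (∀ k → P k → m ≤ k)

module _ {n : ℕ} (G : Graph n) where
  open Graph G

  Walk : Rel (Fin n) 0ℓ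
  Walk = Star _~_

  vertices : ∀ {u v} → Walk u v → List (Fin n)
  vertices {u} ε       = u ∷ []
  vertices {u} (_ ◅ w) = u ∷ vertices w

  internal : ∀ {u v} → Walk u v → List (Fin n)
  internal ε                           = []
  internal (_ ◅ ε)                     = []
  internal (_ ◅ w@(_◅_ {i = x} _ _))   = x ∷ internal w

  length : ∀ {u v} → Walk u v → ℕ
  length ε       = 0
  length (_ ◅ w) = suc (length w)

  Path : Rel (Fin n) 0ℓ
  Path u v = Σ[ w ∈ Walk u v ] Unique (vertices w)

  Connected : Set
  Connected = ∀ u v → Path u v

  -- d(u,v) = d
  IsDistance : Fin n → Fin n → ℕ → Set
  IsDistance u v = IsLeast (λ d → Σ[ p ∈ Path u v ] length (proj₁ p) ≡ d)

  IsGeodesic : ∀ {u v} → Path u v → Set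
  IsGeodesic {u} {v} p = IsDistance u v (length (proj₁ p))

  -- Linked compares internal vertices consecutive on the path; on a geodesic
  -- these are exactly the internal vertices adjacent in G.
  VertexProper : ∀ {k} → (Fin n → Fin k) → ∀ {u v} → Path u v → Set
  VertexProper c p = Linked (λ x y → c x ≢ c y) (internal (proj₁ p))

  -- An uncolored path is vertex-proper exactly when it has no internal vertex.
  UncoloredProper : ∀ {u v} → Path u v → Set
  UncoloredProper p = internal (proj₁ p) ≡ []

  StrongProper : (∀ {u v} → Path u v → Set) → Set
  StrongProper Proper =
    ∀ u v → u ≢ v → Σ[ p ∈ Path u v ] IsGeodesic p × Proper p

  -- With zero colors no vertex is colored; otherwise every vertex is.
  StrongProperWith : ℕ → Set
  StrongProperWith zero    = StrongProper UncoloredProper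
  StrongProperWith (suc k) =
    ∃[ c ] StrongProper (VertexProper {suc k} c)

  -- spvc(G) = k
  IsSpvc : ℕ → Set
  IsSpvc = IsLeast StrongProperWith

complete : ∀ n → Graph n
complete n = record
  { _~_   = _≢_
  ; ~-sym = λ u≢v v≡u → u≢v (sym v≡u)
  ; ~-irr = λ _ v≢v → v≢v refl
  ; _~?_  = λ u v → ¬? (u ≟ᶠ v)
  }

fromRel : ∀ {n} {R : Rel (Fin n) 0ℓ} → Decidable R → Graph n
fromRel {R = R} R? = record
  { _~_   = λ u v → u ≢ v × (R u v ⊎ R v u)
  ; ~-sym = λ (u≢v , r) → (λ v≡u → u≢v (sym v≡u)) , swap r
  ; ~-irr = λ _ (v≢v , _) → v≢v refl
  ; _~?_  = λ u v → ¬? (u ≟ᶠ v) ×-dec (R? u v ⊎-dec R? v u)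
  }

-- K₁,ₘ with center zero
star : ∀ m → Graph (suc m)
star m = fromRel {R = λ u _ → u ≡ zero} (λ u _ → u ≟ᶠ zero)

path : ∀ n → Graph n
path n = fromRel {R = λ u v → suc (toℕ u) ≡ toℕ v}
                 (λ u v → suc (toℕ u) ≟ⁿ toℕ v)

-- the n-cycle when n ≥ 3
cycle : ∀ n → .{{NonZero n}} → Graph n
cycle n = fromRel {R = λ u v → suc (toℕ u) % n ≡ toℕ v}
                  (λ u v → suc (toℕ u) % n ≟ⁿ toℕ v)

deleteEdge : ∀ {n} → Graph n → Fin n → Fin n → Graph n
deleteEdge {n} G a b = record
  { _~_   = λ u v → u ~ v × ¬ IsAB u v
  ; ~-sym = λ (u~v , ≢ab) → ~-sym u~v , λ ab → ≢ab (flipAB ab)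
  ; ~-irr = λ v (v~v , _) → ~-irr v v~v
  ; _~?_  = λ u v → (u ~? v) ×-dec
      ¬? (((u ≟ᶠ a) ×-dec (v ≟ᶠ b)) ⊎-dec ((u ≟ᶠ b) ×-dec (v ≟ᶠ a)))
  }
  where
  open Graph G
  IsAB : Rel (Fin n) 0ℓ
  IsAB u v = (u ≡ a × v ≡ b) ⊎ (u ≡ b × v ≡ a)
  flipAB : ∀ {u v} → IsAB v u → IsAB u v
  flipAB (inj₁ (p , q)) = inj₂ (q , p)
  flipAB (inj₂ (p , q)) = inj₁ (q , p)

-- The new vertex is zero, with neighborhood N; each old vertex v becomes suc v.
addVertex : ∀ {n} → Graph n → {N : U.Pred (Fin n) 0ℓ} → U.Decidable N →
            Graph (suc n)
addVertex {n} G {N} N? = record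
  { _~_ = Adj ; ~-sym = λ {u} {v} → adj-sym u v ; ~-irr = adj-irr ; _~?_ = adj? }
  where
  open Graph G
  Adj : Rel (Fin (suc n)) 0ℓ
  Adj zero    zero    = ⊥
  Adj zero    (suc v) = N v
  Adj (suc u) zero    = N u
  Adj (suc u) (suc v) = u ~ v
  adj-sym : ∀ u v → Adj u v → Adj v u
  adj-sym zero    (suc v) r = r
  adj-sym (suc u) zero    r = r
  adj-sym (suc u) (suc v) r = ~-sym r
  adj-irr : ∀ v → ¬ Adj v v
  adj-irr (suc v) = ~-irr v
  adj? : Decidable Adj
  adj? zero    zero    = no λ ()
  adj? zero    (suc v) = N? v
  adj? (suc u) zero    = N? u
  adj? (suc u) (suc v) = u ~? v

attachPendant : ∀ {n} → Graph n → Fin n → Graph (suc n)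
attachPendant G x = addVertex G (_≟ᶠ x)

-- ab is meant to be an edge; vertices are renumbered as in addVertex.
subdivide : ∀ {n} → Graph n → Fin n → Fin n → Graph (suc n)
subdivide G a b =
  addVertex (deleteEdge G a b) (λ v → (v ≟ᶠ a) ⊎-dec (v ≟ᶠ b))

-- the disjoint union of G and H together with the edge between x and y
joinByEdge : ∀ {m n} → Graph m → Fin m → Graph n → Fin n → Graph (m + n)
joinByEdge {m} {n} G x H y = record
  { _~_   = λ u v → Adj (splitAt m u) (splitAt m v)
  ; ~-sym = λ {u} {v} → adj-sym (splitAt m u) (splitAt m v)
  ; ~-irr = λ v → adj-irr (splitAt m v)
  ; _~?_  = λ u v → adj? (splitAt m u) (splitAt m v)
  }
  where
  module G = Graph G
  module H = Graph H
  Adj : Rel (Fin m ⊎ Fin n) 0ℓ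
  Adj (inj₁ u) (inj₁ v) = u G.~ v
  Adj (inj₁ u) (inj₂ v) = u ≡ x × v ≡ y
  Adj (inj₂ u) (inj₁ v) = u ≡ y × v ≡ x
  Adj (inj₂ u) (inj₂ v) = u H.~ v
  adj-sym : ∀ s t → Adj s t → Adj t s
  adj-sym (inj₁ u) (inj₁ v) r       = G.~-sym r
  adj-sym (inj₁ u) (inj₂ v) (p , q) = q , p
  adj-sym (inj₂ u) (inj₁ v) (p , q) = q , p
  adj-sym (inj₂ u) (inj₂ v) r       = H.~-sym r
  adj-irr : ∀ s → ¬ Adj s s
  adj-irr (inj₁ v) = G.~-irr v
  adj-irr (inj₂ v) = H.~-irr v
  adj? : Decidable Adj
  adj? (inj₁ u) (inj₁ v) = u G.~? v
  adj? (inj₁ u) (inj₂ v) = (u ≟ᶠ x) ×-dec (v ≟ᶠ y)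
  adj? (inj₂ u) (inj₁ v) = (u ≟ᶠ y) ×-dec (v ≟ᶠ x)
  adj? (inj₂ u) (inj₂ v) = u H.~? v

-- The vertices of degree 2 are 0 and 1.
K₄-e : Graph 4
K₄-e = deleteEdge (complete 4) (# 0) (# 1)

{-# OPTIONS --safe #-}
module Submission where

-- Call an edge critical if it is the middle of a geodesic of length 3.  A colouring whose
-- critical edges are properly coloured makes every geodesic vertex-proper, so it suffices to
-- merge colour classes along non-critical pairs.  If n ≥ 7, four such mergers are always
-- possible.  Fix a critical edge and witnesses x, y at distance 3.
--   * If every other vertex is adjacent to x or y, then either both neighbourhoods have two
--     members and each contains a non-critical pair, which joins the opposite end, or
--     y, say, is pendant at v and N(x) ∩ N(v) against the rest is a 2-colouring.
--   * If r is adjacent to neither, then {x, y, r} saves two colours.  Unless the remaining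
--     vertices save two more, deleting one vertex c from them leaves a clique of critical
--     edges, all of whose witnesses lie in {x, y, r, c}; this leaves few configurations on
--     seven vertices, which are enumerated.
-- For n ≤ 6 the graphs themselves are enumerated, from an induced path x u v y if n ≥ 5.

open import Defs
open import Data.Bool using (Bool; true; false; T)
open import Data.Bool.Properties using (T?)
open import Data.Empty using (⊥-elim)
open import Data.Fin using (Fin; zero; suc; #_; toℕ; fromℕ<; punchIn; punchOut; _↑ˡ_; _↑ʳ_)
open import Data.Fin.Patterns using (0F; 1F; 2F; 3F; 4F; 5F)
open import Data.Fin.Permutation using (↔⇒≡)
open import Data.Fin.Properties
  using (any?; all?; toℕ<n; toℕ-fromℕ<; pigeonhole; <⇒≢; suc-injective; punchOut-injective;
         injective⇒≤; ↑ˡ-injective; ↑ʳ-injective)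
  renaming (_≟_ to _≟ᶠ_)
open import Data.List using (List; []; _∷_; concatMap; allFin)
  renaming (map to mapᴸ; lookup to lookupᴸ; length to lengthᴸ)
open import Data.List.Membership.Propositional using (_∈_)
open import Data.List.Membership.Propositional.Properties using (∈-lookup)
open import Data.List.Relation.Unary.All as All using (All; []; _∷_)
open import Data.List.Relation.Unary.AllPairs using (AllPairs; []; _∷_)
open import Data.List.Relation.Unary.Any as Any using (Any; here; there; satisfied)
open import Data.List.Relation.Unary.Linked using (Linked; []; [-]; _∷_)
open import Data.List.Relation.Unary.Unique.Propositional using (Unique)
open import Data.Nat using (ℕ; zero; suc; _+_; _∸_; _≤_; _<_; _≤?_; s≤s; z≤n; s≤s⁻¹)
open import Data.Nat.Properties
  using (≤-refl; ≤-trans; m≤n⇒m≤1+n; n≮n; ≮⇒≥; ≰⇒>; <⇒≤; n<1+n; n≤1+n; m≤n+m; +-comm; +-assoc;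
         +-cancelˡ-≤; +-monoˡ-≤; +-suc; ≤-reflexive; m+[n∸m]≡n; module ≤-Reasoning)
open import Data.Product using (Σ-syntax; ∃-syntax; _×_; _,_; proj₁; proj₂)
open import Data.Sum as Sum using (_⊎_; inj₁; inj₂)
open import Data.Unit using (⊤; tt)
open import Data.Vec using (Vec; []; _∷_; lookup; tabulate; map)
open import Data.Vec.Properties using (lookup∘tabulate)
open import Data.Vec.Relation.Unary.All using ([]; _∷_)
open import Data.Vec.Relation.Unary.AllPairs using ([]; _∷_)
open import Data.Vec.Relation.Unary.Unique.Propositional.Properties using (lookup-injective)
open import Function using (_∘_; id; _⇔_; mk⇔; Equivalence; Inverse; mk↔ₛ′)
open import Function.Definitions using (Injective)
open import Function.Properties.Bijection using (⤖⇒↔)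
open import Function.Properties.Inverse using (↔⇒⤖)
open import Relation.Binary using (Decidable)
open import Relation.Binary.Construct.Closure.ReflexiveTransitive using (ε; _◅_)
open import Relation.Binary.PropositionalEquality
  using (_≡_; _≢_; refl; sym; trans; cong; subst; subst₂)
open import Relation.Nullary using (¬_; Dec; yes; no)
open import Relation.Nullary.Decidable
  using (_×-dec_; _⊎-dec_; _→-dec_; ¬?; map′; True; toWitness; fromWitness; isYes; decidable-stable)

open Equivalence using (to; from)

-- Critical edges and the colourings that respect them

module _ {n : ℕ} (G : Graph n) where
  open Graph G

  Far : Fin n → Fin n → Set
  Far u v = u ≢ v × ¬ (u ~ v) × (∀ w → u ~ w → ¬ (w ~ v))

  far? : Decidable Far
  far? u v = ¬? (u ≟ᶠ v) ×-dec ¬? (u ~? v) ×-dec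
             all? λ w → (u ~? w) →-dec ¬? (w ~? v)

  -- The edge p q is the middle edge of a geodesic of length 3.
  Critical : Fin n → Fin n → Set
  Critical p q = p ~ q × ∃[ z ] (z ~ p × ∃[ z′ ] (q ~ z′ × Far z z′))

  critical? : Decidable Critical
  critical? p q = (p ~? q) ×-dec any? λ z → (z ~? p) ×-dec
                  any? λ z′ → (q ~? z′) ×-dec far? z z′

  Valid : ∀ {k} → (Fin n → Fin k) → Set
  Valid c = ∀ p q → c p ≡ c q → ¬ Critical p q

  valid? : ∀ {k} (c : Fin n → Fin k) → Dec (Valid c)
  valid? c = all? λ p → all? λ q → (c p ≟ᶠ c q) →-dec ¬? (critical? p q)

  Colourable : ℕ → Set
  Colourable k = ∃[ c ] Valid (lookup {A = Fin k} c)

  -- For an induced subgraph of a larger graph, adjacency is visible from inside, whereas witnesses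
  -- of criticality may lie outside; hence this stronger condition next to `Valid`.
  Proper : ∀ {k} → (Fin n → Fin k) → Set
  Proper c = ∀ i j → c i ≡ c j → ¬ (i ~ j)

  proper? : ∀ {k} (c : Fin n → Fin k) → Dec (Proper c)
  proper? c = all? λ i → all? λ j → (c i ≟ᶠ c j) →-dec ¬? (i ~? j)

-- Encoding and enumeration of small graphs

-- Vertices are added one at a time; the newest is zero and brings its adjacency row.
Code : ℕ → Set
Code zero    = ⊤
Code (suc m) = Vec Bool m × Code m

adj : ∀ {m} → Code m → Fin m → Fin m → Bool
adj (r , c) zero    zero    = false
adj (r , c) zero    (suc j) = lookup r j
adj (r , c) (suc i) zero    = lookup r i
adj (r , c) (suc i) (suc j) = adj c i j

adj-sym : ∀ {m} (c : Code m) i j → T (adj c i j) → T (adj c j i)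
adj-sym (r , c) zero    (suc j) t = t
adj-sym (r , c) (suc i) zero    t = t
adj-sym (r , c) (suc i) (suc j) t = adj-sym c i j t

adj-irr : ∀ {m} (c : Code m) i → ¬ T (adj c i i)
adj-irr (r , c) (suc i) = adj-irr c i

graph : ∀ {m} → Code m → Graph m
graph c = record
  { _~_   = λ i j → T (adj c i j)
  ; ~-sym = λ {i} {j} → adj-sym c i j
  ; ~-irr = adj-irr c
  ; _~?_  = λ i j → T? (adj c i j)
  }

allBool? : {P : Bool → Set} → (∀ b → Dec (P b)) → Dec (∀ b → P b)
allBool? P? = map′ (λ { (f , t) false → f ; (f , t) true → t })
                   (λ p → p false , p true) (P? false ×-dec P? true)

allRows? : ∀ m {P : Vec Bool m → Set} → (∀ r → Dec (P r)) → Dec (∀ r → P r)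
allRows? zero    P? = map′ (λ { p [] → p }) (λ p → p []) (P? [])
allRows? (suc m) P? = map′ (λ { p (b ∷ r) → p b r }) (λ p b r → p (b ∷ r))
                           (allBool? λ b → allRows? m λ r → P? (b ∷ r))

-- A vertex that extends a clique of size `j` has its first `j` entries forced, so only the other
-- `m` are enumerated.
allTrueRows? : ∀ j m {P : Vec Bool (j + m) → Set} → (∀ r → Dec (P r)) →
               Dec (∀ r → (∀ i → T (lookup r (i ↑ˡ m))) → P r)
allTrueRows? zero    m P? = map′ (λ p r _ → p r) (λ p r → p r λ ()) (allRows? m P?)
allTrueRows? (suc j) m P? =
  map′ (λ { p (true ∷ r) t → p r (t ∘ suc) ; p (false ∷ r) t → ⊥-elim (t zero) })
       (λ p r t → p (true ∷ r) λ { zero → tt ; (suc i) → t i })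
       (allTrueRows? j m λ r → P? (true ∷ r))

allCodes? : ∀ m {P : Code m → Set} → (∀ c → Dec (P c)) → Dec (∀ c → P c)
allCodes? zero    P? = map′ (λ p _ → p) (λ p → p tt) (P? tt)
allCodes? (suc m) P? = map′ (λ p (r , c) → p c r) (λ p c r → p (r , c))
                            (allCodes? m λ c → allRows? m λ r → P? (r , c))

anyVec? : ∀ {k} m {P : Vec (Fin k) m → Set} → (∀ v → Dec (P v)) → Dec (∃[ v ] P v)
anyVec? zero    P? = map′ (λ p → [] , p) (λ { ([] , p) → p }) (P? [])
anyVec? (suc m) P? =
  map′ (λ (i , v , p) → i ∷ v , p) (λ { (i ∷ v , p) → i , v , p })
       (any? λ i → anyVec? m λ v → P? (i ∷ v))

colourable? : ∀ {n} (G : Graph n) k → Dec (Colourable G k)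
colourable? {n} G k = anyVec? n λ c → valid? G (lookup c)

-- Pruning after each new vertex keeps the enumerations small.
module _ (Base : Graph 4 → Set) (Step : ∀ j → Graph (suc j + 4) → Set) where

  Admissible : ∀ j → Code (j + 4) → Set
  Admissible zero    c       = Base (graph c)
  Admissible (suc j) (r , c) = Admissible j c × Step j (graph (r , c))

  module _ (base? : ∀ g → Dec (Base g))
           (allSteps? : ∀ j (c : Code (j + 4)) {P : Vec Bool (j + 4) → Set} →
              (∀ r → Dec (P r)) → Dec (∀ r → Step j (graph (r , c)) → P r)) where

    allAdmissible? : ∀ j {P : Code (j + 4) → Set} → (∀ c → Dec (P c)) →
                     Dec (∀ c → Admissible j c → P c)
    allAdmissible? zero    P? = allCodes? 4 λ c → base? (graph c) →-dec P? c
    allAdmissible? (suc j) P? =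
      map′ (λ p (r , c) (a , s) → p c a r s) (λ p c a r s → p (r , c) (a , s))
        (allAdmissible? j λ c → allSteps? j c λ r → P? (r , c))

-- Keeps the base vertices `a` and `b` without a common neighbour. The shift is due to new vertices
-- being placed in front of the base.
NotBothEnds : ∀ j → Fin 4 → Fin 4 → Graph (suc j + 4) → Set
NotBothEnds j a b g = zero ~ suc j ↑ʳ a → ¬ (zero ~ suc j ↑ʳ b)
  where open Graph g

notBothEnds? : ∀ j a b g → Dec (NotBothEnds j a b g)
notBothEnds? j a b g = (zero ~? suc j ↑ʳ a) →-dec ¬? (zero ~? suc j ↑ʳ b)
  where open Graph g

PathBase : Graph 4 → Set
PathBase g = 0F ~ 1F × 1F ~ 2F × 2F ~ 3F × Far g 0F 3F
  where open Graph g

pathBase? : ∀ g → Dec (PathBase g)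
pathBase? g = (0F ~? 1F) ×-dec (1F ~? 2F) ×-dec (2F ~? 3F) ×-dec far? g 0F 3F
  where open Graph g

PathStep : ∀ j → Graph (suc j + 4) → Set
PathStep j = NotBothEnds j 0F 3F

allPathSteps? : ∀ j (c : Code (j + 4)) {P : Vec Bool (j + 4) → Set} →
                (∀ r → Dec (P r)) → Dec (∀ r → PathStep j (graph (r , c)) → P r)
allPathSteps? j c P? = allRows? (j + 4) λ r → notBothEnds? j 0F 3F (graph (r , c)) →-dec P? r

-- For an edge `u v`, this is criticality with both witnesses among the four base vertices.
Separated : ∀ j → Graph (j + 4) → Fin (j + 4) → Fin (j + 4) → Set
Separated j g u v = ∃[ a ] (j ↑ʳ a ~ u × ∃[ b ] (v ~ j ↑ʳ b × Far g (j ↑ʳ a) (j ↑ʳ b)))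
  where open Graph g

separated? : ∀ j g → Decidable (Separated j g)
separated? j g u v = any? λ a → (j ↑ʳ a ~? u) ×-dec any? λ b →
                     (v ~? j ↑ʳ b) ×-dec far? g (j ↑ʳ a) (j ↑ʳ b)
  where open Graph g

-- The old vertices are x, y, r, c; the new ones form a clique whose edges are
-- critical by virtue of the old vertices.
CliqueBase : Graph 4 → Set
CliqueBase g = Far g 0F 1F × ¬ (0F ~ 2F) × ¬ (1F ~ 2F) × ¬ (0F ~ 3F)
  where open Graph g

cliqueBase? : ∀ g → Dec (CliqueBase g)
cliqueBase? g = far? g 0F 1F ×-dec ¬? (0F ~? 2F) ×-dec ¬? (1F ~? 2F) ×-dec ¬? (0F ~? 3F)
  where open Graph g

CliqueStep : ∀ j → Graph (suc j + 4) → Set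
CliqueStep j g = (∀ i → zero ~ suc (i ↑ˡ 4)) × NotBothEnds j 0F 1F g ×
                 (∀ i → Separated (suc j) g zero (suc (i ↑ˡ 4)))
  where open Graph g

allCliqueSteps? : ∀ j (c : Code (j + 4)) {P : Vec Bool (j + 4) → Set} →
                  (∀ r → Dec (P r)) → Dec (∀ r → CliqueStep j (graph (r , c)) → P r)
allCliqueSteps? j c P? =
  map′ (λ f r (t , s) → f r t s) (λ f r t s → f r (t , s))
    (allTrueRows? j 4 λ r →
      (notBothEnds? j 0F 1F (graph (r , c)) ×-dec
       all? λ i → separated? (suc j) (graph (r , c)) zero (suc (i ↑ˡ 4)))
      →-dec P? r)

cliqueColouring : Vec (Fin 3) 4 → Fin 7 → Fin 3
cliqueColouring e = lookup (0F ∷ 1F ∷ 2F ∷ e)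

-- Colours of x, y, r, c (against 0, 1, 2 on the clique) that jointly cover all
-- configurations, found by a greedy search; likewise for the other palettes.
properPalette : Vec (Vec (Fin 3) 4) 12
properPalette =
  (0F ∷ 1F ∷ 0F ∷ 2F ∷ []) ∷ (1F ∷ 0F ∷ 1F ∷ 2F ∷ []) ∷ (2F ∷ 0F ∷ 2F ∷ 1F ∷ []) ∷
  (0F ∷ 1F ∷ 2F ∷ 0F ∷ []) ∷ (1F ∷ 2F ∷ 1F ∷ 0F ∷ []) ∷ (0F ∷ 2F ∷ 0F ∷ 1F ∷ []) ∷
  (2F ∷ 1F ∷ 2F ∷ 0F ∷ []) ∷ (0F ∷ 1F ∷ 1F ∷ 0F ∷ []) ∷ (1F ∷ 0F ∷ 0F ∷ 1F ∷ []) ∷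
  (1F ∷ 0F ∷ 2F ∷ 1F ∷ []) ∷ (2F ∷ 0F ∷ 0F ∷ 2F ∷ []) ∷ (2F ∷ 0F ∷ 1F ∷ 2F ∷ []) ∷ []

validPalette : Vec (Vec (Fin 3) 4) 3
validPalette =
  (0F ∷ 0F ∷ 0F ∷ 0F ∷ []) ∷ (0F ∷ 0F ∷ 1F ∷ 1F ∷ []) ∷ (0F ∷ 0F ∷ 2F ∷ 2F ∷ []) ∷ []

-- In the second alternative the clique has no fourth vertex, so these seven vertices are all.
CliqueOutcome : Code 7 → Set
CliqueOutcome c =
  (∃[ i ] Proper (graph c) (cliqueColouring (lookup properPalette i))) ⊎
  (∃[ i ] Valid (graph c) (cliqueColouring (lookup validPalette i))) ×
  (∀ r → ¬ CliqueStep 3 (graph (r , c)))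

-- Opaque, so that the enumeration is not evaluated again where its result is used.
abstract
  cliqueCheck : ∀ c → Admissible CliqueBase CliqueStep 3 c → CliqueOutcome c
  cliqueCheck = toWitness
    {a? = allAdmissible? CliqueBase CliqueStep cliqueBase? allCliqueSteps? 3 λ c →
      (any? λ i → proper? (graph c) (cliqueColouring (lookup properPalette i))) ⊎-dec
      (any? λ i → valid? (graph c) (cliqueColouring (lookup validPalette i))) ×-dec
      allCliqueSteps? 3 c λ _ → no λ ()} tt

-- Isomorphism search and the checks for orders four, five and six

permutations : ∀ n → List (Vec (Fin n) n)
permutations zero    = [] ∷ []
permutations (suc n) = concatMap (λ i → mapᴸ (λ p → i ∷ map (punchIn i) p) (permutations n)) (allFin (suc n))

-- Injectivity is tested along with the edges, so nothing has to be proved about the list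
-- `permutations`.
IsIso : ∀ {n} → Graph n → Graph n → Vec (Fin n) n → Set
IsIso G H σ = (∀ i j → (i G.~ j → lookup σ i H.~ lookup σ j) × (lookup σ i H.~ lookup σ j → i G.~ j)) ×
              (∀ i j → lookup σ i ≡ lookup σ j → i ≡ j)
  where
  module G = Graph G
  module H = Graph H

isIso? : ∀ {n} (G H : Graph n) σ → Dec (IsIso G H σ)
isIso? G H σ =
  (all? λ i → all? λ j → ((i G.~? j) →-dec (lookup σ i H.~? lookup σ j)) ×-dec
                         ((lookup σ i H.~? lookup σ j) →-dec (i G.~? j)))
  ×-dec (all? λ i → all? λ j → (lookup σ i ≟ᶠ lookup σ j) →-dec (i ≟ᶠ j))
  where
  module G = Graph G
  module H = Graph H

infix 4 _≈_ _≈?_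

record _≈_ {n} (G H : Graph n) : Set where
  constructor listed
  field
    search : Any (IsIso G H) (permutations n)

_≈?_ : ∀ {n} (G H : Graph n) → Dec (G ≈ H)
_≈?_ {n} G H = map′ listed _≈_.search (Any.any? (isIso? G H) (permutations n))

net : Graph 6
net = attachPendant (attachPendant (attachPendant (complete 3) (# 0)) (suc (# 1))) (suc (suc (# 2)))

pathPalette : Vec (Vec (Fin 2) 6) 4
pathPalette =
  (0F ∷ 1F ∷ 0F ∷ 1F ∷ 0F ∷ 1F ∷ []) ∷ (0F ∷ 1F ∷ 1F ∷ 0F ∷ 1F ∷ 0F ∷ []) ∷
  (0F ∷ 0F ∷ 0F ∷ 0F ∷ 1F ∷ 0F ∷ []) ∷ (0F ∷ 0F ∷ 0F ∷ 1F ∷ 0F ∷ 0F ∷ []) ∷ []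

abstract
  -- Without far pairs the diameter is at most two, and four non-complete graphs of order four
  -- remain.
  fourVertexCheck : (c : Code 4) → let g = graph c in
    (∀ u v → ¬ Far g u v) → ¬ (∀ u v → u ≢ v → T (adj c u v)) →
    star 3 ≈ g ⊎ cycle 4 ≈ g ⊎ attachPendant (complete 3) (# 0) ≈ g ⊎ K₄-e ≈ g
  fourVertexCheck = toWitness {a? = allCodes? 4 λ c → let g = graph c in
    (all? λ u → all? λ v → ¬? (far? g u v)) →-dec
    ¬? (all? λ u → all? λ v → ¬? (u ≟ᶠ v) →-dec T? (adj c u v)) →-dec
    ((star 3 ≈? g) ⊎-dec (cycle 4 ≈? g) ⊎-dec
    (attachPendant (complete 3) (# 0) ≈? g) ⊎-dec (K₄-e ≈? g))} tt

  -- The base is an induced path whose ends stay at distance three; a fifth vertex that is not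
  -- isolated makes the graph connected.
  fiveVertexCheck : ∀ c → Admissible PathBase PathStep 1 c →
    let g = graph c in
    (∃[ i ] T (adj c zero i)) →
     path 5 ≈ g ⊎ subdivide (star 3) (# 0) (# 1) ≈ g
      ⊎ attachPendant (attachPendant (complete 3) (# 0)) (suc (# 1)) ≈ g
      ⊎ joinByEdge (complete 3) (# 0) (path 2) (# 0) ≈ g
      ⊎ attachPendant (cycle 4) (# 0) ≈ g
      ⊎ attachPendant K₄-e (# 0) ≈ g
  fiveVertexCheck = toWitness {a? = allAdmissible? PathBase PathStep pathBase? allPathSteps? 1 λ c →
    let g = graph c in
    (any? λ i → T? (adj c zero i)) →-dec
     ((path 5 ≈? g) ⊎-dec (subdivide (star 3) (# 0) (# 1) ≈? g)
      ⊎-dec (attachPendant (attachPendant (complete 3) (# 0)) (suc (# 1)) ≈? g)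
      ⊎-dec (joinByEdge (complete 3) (# 0) (path 2) (# 0) ≈? g)
      ⊎-dec (attachPendant (cycle 4) (# 0) ≈? g)
      ⊎-dec (attachPendant K₄-e (# 0) ≈? g))} tt

  -- The critical edges of the net form a triangle and so need a third colour; in all other cases
  -- one of four fixed colourings works.
  sixVertexCheck : ∀ c → Admissible PathBase PathStep 2 c →
    (∃[ i ] Valid (graph c) (lookup (lookup pathPalette i))) ⊎ net ≈ graph c
  sixVertexCheck = toWitness {a? = allAdmissible? PathBase PathStep pathBase? allPathSteps? 2 λ c →
    (any? λ i → valid? (graph c) (lookup (lookup pathPalette i))) ⊎-dec (net ≈? graph c)} tt

-- Geodesics, and bounds on the number of colours

module _ {n : ℕ} (G : Graph n) where
  open Graph G

  Shortest : ∀ {u v} → Walk G u v → Set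
  Shortest {u} {v} w = ∀ (w′ : Walk G u v) → length G w ≤ length G w′

  shortest-tail : ∀ {u a v} (e : u ~ a) (w : Walk G a v) → Shortest (e ◅ w) → Shortest w
  shortest-tail e w s w′ = s≤s⁻¹ (s (e ◅ w′))

  suffix : ∀ {u v a} (w : Walk G u v) → a ∈ vertices G w →
           Σ[ w′ ∈ Walk G a v ] length G w′ ≤ length G w
  suffix ε       (here refl) = ε , z≤n
  suffix (e ◅ w) (here refl) = e ◅ w , ≤-refl
  suffix (e ◅ w) (there a∈w) with w′ , le ← suffix w a∈w = w′ , m≤n⇒m≤1+n le

  -- At a repeated vertex the walk could be cut short by `suffix`.
  shortest-unique : ∀ {u v} (w : Walk G u v) → Shortest w → Unique (vertices G w)
  shortest-unique ε       s = [] ∷ []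
  shortest-unique (e ◅ w) s =
    All.tabulate (λ { a∈w refl → let w′ , le = suffix w a∈w in n≮n _ (≤-trans (s w′) le) })
    ∷ shortest-unique w (shortest-tail e w s)

  walkOfLength? : ∀ d u v → Dec (Σ[ w ∈ Walk G u v ] length G w ≡ d)
  walkOfLength? zero    u v = map′ (λ { refl → ε , refl }) (λ { (ε , _) → refl }) (u ≟ᶠ v)
  walkOfLength? (suc d) u v =
    map′ (λ { (a , e , w , refl) → e ◅ w , refl }) (λ { (e ◅ w , refl) → _ , e , w , refl })
         (any? λ a → (u ~? a) ×-dec walkOfLength? d a v)

  -- It is decidable whether a walk of some smaller length exists; the bound `k` makes the descent
  -- terminate.
  shorten : ∀ {u v} k (w : Walk G u v) → length G w ≤ k → Σ[ w′ ∈ Walk G u v ] Shortest w′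
  shorten {u} {v} k w le with any? {n = length G w} (λ d → walkOfLength? (toℕ d) u v)
  shorten {u} {v} k w le | no none = w , λ w′ → ≮⇒≥ λ lt →
    none (fromℕ< lt , w′ , sym (toℕ-fromℕ< lt))
  shorten {u} {v} zero    w le | yes (d , _) = ⊥-elim (n≮n _ (≤-trans (s≤s z≤n) (≤-trans (toℕ<n d) le)))
  shorten {u} {v} (suc k) w le | yes (d , w′ , eq) =
    shorten k w′ (s≤s⁻¹ (≤-trans (subst (_< length G w) (sym eq) (toℕ<n d)) le))

  -- Replacing the first three steps by at most two would shorten the walk.
  shortest-far : ∀ {z p q z′ v} (e₁ : z ~ p) (e₂ : p ~ q) (e₃ : q ~ z′) (w : Walk G z′ v) →
                 Shortest (e₁ ◅ e₂ ◅ e₃ ◅ w) → Far G z z′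
  shortest-far e₁ e₂ e₃ w s =
    (λ { refl → absurd (≤-trans (s w) (m≤n⇒m≤1+n (m≤n⇒m≤1+n ≤-refl))) }) ,
    (λ e → absurd (≤-trans (s (e ◅ w)) (m≤n⇒m≤1+n ≤-refl))) ,
    (λ _ e e′ → absurd (s (e ◅ e′ ◅ w)))
    where
    absurd : ¬ (3 + length G w ≤ 2 + length G w)
    absurd = n≮n _

  -- Two consecutive internal vertices are the middle of three consecutive steps, hence span a
  -- critical edge by `shortest-far`.
  shortest-proper : ∀ {k} (c : Fin n → Fin k) → Valid G c →
                    ∀ {u v} (w : Walk G u v) → Shortest w →
                    Linked (λ a b → c a ≢ c b) (internal G w)
  shortest-proper c valid ε                    s = []
  shortest-proper c valid (e ◅ ε)              s = []
  shortest-proper c valid (e₁ ◅ e₂ ◅ ε)        s = [-]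
  shortest-proper c valid (e₁ ◅ e₂ ◅ e₃ ◅ w) s =
    (λ eq → valid _ _ eq (e₂ , _ , e₁ , _ , e₃ , shortest-far e₁ e₂ e₃ w s))
    ∷ shortest-proper c valid (e₂ ◅ e₃ ◅ w) (shortest-tail e₁ (e₂ ◅ e₃ ◅ w) s)

  geodesic : Connected G → ∀ u v → Σ[ p ∈ Path G u v ] IsGeodesic G p × Shortest (proj₁ p)
  geodesic connected u v with w , s ← shorten _ (proj₁ (connected u v)) ≤-refl =
    p , ((p , refl) , λ { _ (p′ , refl) → s (proj₁ p′) }) , s
    where
    p : Path G u v
    p = w , shortest-unique w s

  valid⇒strong : Connected G → ∀ {k} (c : Fin n → Fin k) → Valid G c → Fin n → StrongProperWith G k
  -- The given vertex would have a colour in `Fin 0`; the special meaning of zero colours thus never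
  -- interferes.
  valid⇒strong connected {zero}  c valid a with () ← c a
  valid⇒strong connected {suc k} c valid _ = c , λ u v _ →
    let p , g , s = geodesic connected u v in p , g , shortest-proper c valid (proj₁ p) s

  complete⇒strong : (∀ u v → u ≢ v → u ~ v) → StrongProperWith G 0
  complete⇒strong adjacent u v u≢v =
    p , ((p , refl) , λ { _ ((ε , _) , refl) → ⊥-elim (u≢v refl) ; _ ((_ ◅ _ , _) , refl) → s≤s z≤n }) , refl
    where
    p : Path G u v
    p = adjacent u v u≢v ◅ ε , (u≢v ∷ []) ∷ [] ∷ []

  strong₀⇒complete : StrongProperWith G 0 → ∀ u v → u ≢ v → u ~ v
  strong₀⇒complete strong u v u≢v with strong u v u≢v
  ... | (ε , _)          , _ , _ = ⊥-elim (u≢v refl)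
  ... | (e ◅ ε , _)      , _ , _ = e
  ... | (_ ◅ _ ◅ _ , _)  , _ , ()

  -- A path between far vertices that is a geodesic has two consecutive internal vertices, which a
  -- single colour cannot distinguish.
  strong₁⇒¬far : StrongProperWith G 1 → ∀ u v → ¬ Far G u v
  strong₁⇒¬far (c , strong) u v (u≢v , u≁v , apart) with strong u v u≢v
  ... | (ε , _)                   , _ , _       = u≢v refl
  ... | (e ◅ ε , _)               , _ , _       = u≁v e
  ... | (e₁ ◅ e₂ ◅ ε , _)         , _ , _       = apart _ e₁ e₂
  ... | (_◅_ {j = a} _ (_◅_ {j = b} _ (_ ◅ _)) , _) , _ , a≢b ∷ _ = a≢b (unique (c a) (c b))
    where
    unique : (i j : Fin 1) → i ≡ j
    unique zero zero = refl

  -- A triangle `t` with a pendant vertex `p i` at each corner, indexed for use with the pigeonhole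
  -- principle.
  Net : (p t : Fin 3 → Fin n) → Set
  Net p t = (∀ i → p i ~ t i) × (∀ i a → p i ~ a → a ≡ t i) ×
            (∀ i j → i ≢ j → t i ~ t j × Far G (p i) (p j))

  net? : ∀ p t → Dec (Net p t)
  net? p t = (all? λ i → p i ~? t i) ×-dec
             (all? λ i → all? λ a → (p i ~? a) →-dec (a ≟ᶠ t i)) ×-dec
             (all? λ i → all? λ j → ¬? (i ≟ᶠ j) →-dec ((t i ~? t j) ×-dec far? G (p i) (p j)))

  far-walk : ∀ {u v} → Far G u v → (w : Walk G u v) → length G w ≤ 3 →
             ∃[ a ] ∃[ b ] (u ~ a × b ~ v × internal G w ≡ a ∷ b ∷ [])
  far-walk (u≢v , _)       ε                      _ = ⊥-elim (u≢v refl)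
  far-walk (_ , u≁v , _)   (e ◅ ε)                _ = ⊥-elim (u≁v e)
  far-walk (_ , _ , apart) (e₁ ◅ e₂ ◅ ε)          _ = ⊥-elim (apart _ e₁ e₂)
  far-walk _               (e₁ ◅ e₂ ◅ e₃ ◅ ε)     _ = _ , _ , e₁ , e₃ , refl
  far-walk _               (_ ◅ _ ◅ _ ◅ _ ◅ _) (s≤s (s≤s (s≤s ())))

  -- Two corners share a colour. Their pendants are at distance three, and every geodesic between
  -- these passes through exactly the two corners.
  net⇒¬strong₂ : ∀ {p t} → Net p t → ¬ StrongProperWith G 2
  net⇒¬strong₂ {p} {t} (p~t , only , apart) (c , strong) =
    let i , j , i<j , same = pigeonhole (n<1+n 2) (c ∘ t)
        ti~tj , far = apart i j (<⇒≢ i<j)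
        q , (_ , least) , proper = strong (p i) (p j) (proj₁ far)
        a , b , pi~a , b~pj , eq = far-walk far (proj₁ q) (least 3 (detour far ti~tj , refl))
    in differ (subst (Linked _) eq proper)
         (trans (cong c (only i a pi~a)) (trans same (cong c (sym (only j b (~-sym b~pj))))))
    where
    differ : ∀ {a b} → Linked (λ a b → c a ≢ c b) (a ∷ b ∷ []) → c a ≢ c b
    differ (a≢b ∷ _) = a≢b
    detour : ∀ {i j} → Far G (p i) (p j) → t i ~ t j → Path G (p i) (p j)
    detour {i} {j} (pi≢pj , pi≁pj , _) ti~tj = p~t i ◅ ti~tj ◅ ~-sym (p~t j) ◅ ε ,
      ((λ eq → ~-irr _ (subst (p i ~_) (sym eq) (p~t i))) ∷
       (λ eq → pi≁pj (subst (_~ p j) (sym eq) (~-sym (p~t j)))) ∷ pi≢pj ∷ []) ∷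
      ((λ eq → ~-irr _ (subst (t i ~_) (sym eq) ti~tj)) ∷
       (λ eq → pi≁pj (subst (p i ~_) eq (p~t i))) ∷ []) ∷
      ((λ eq → ~-irr _ (subst (p j ~_) eq (p~t j))) ∷ []) ∷ [] ∷ []

-- Induced subgraphs and isomorphisms

injective⇒onto : ∀ {m n} {f : Fin m → Fin n} → Injective _≡_ _≡_ f → n ≤ m → ∀ y → ∃[ x ] f x ≡ y
injective⇒onto {m} {suc n} {f} inj n≤m y with any? (λ x → f x ≟ᶠ y)
... | yes hit  = hit
-- Punching out the missed value leaves an injection into a set that is too small.
... | no  miss = ⊥-elim (n≮n n (≤-trans n≤m (injective⇒≤ λ {a} {b} eq →
  inj (punchOut-injective (avoid a) (avoid b) eq))))
  where
  avoid : ∀ a → y ≢ f a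
  avoid a eq = miss (a , sym eq)

record Induces {m n} (g : Graph m) (G : Graph n) (φ : Fin m → Fin n) : Set where
  constructor induced
  private
    module g = Graph g
    module G = Graph G
  field
    edges : ∀ i j → (i g.~ j) ⇔ (φ i G.~ φ j)

open Induces using (edges)

module _ {m n} {g : Graph m} {G : Graph n} {φ : Fin m → Fin n} (ind : Induces g G φ) where

  -- A subgraph offers fewer common neighbours, so distance at least three is inherited.
  far-restrict : ∀ {i j} → Far G (φ i) (φ j) → Far g i j
  far-restrict (i≢j , i≁j , apart) =
    i≢j ∘ cong φ , i≁j ∘ to (edges ind _ _) , λ w e e′ → apart (φ w) (to (edges ind _ _) e) (to (edges ind _ _) e′)

  module _ (ψ : Fin n → Fin m) (φψ : ∀ v → φ (ψ v) ≡ v) where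

    edge-restrict : ∀ {u v} → Graph._~_ G u v → Graph._~_ g (ψ u) (ψ v)
    edge-restrict {u} {v} e = from (edges ind _ _) (subst₂ (Graph._~_ G) (sym (φψ u)) (sym (φψ v)) e)

    -- The right inverse `ψ` says that `φ` reaches every vertex, so the witnesses can be pulled back
    -- as well.
    critical-restrict : ∀ {p q} → Critical G p q → Critical g (ψ p) (ψ q)
    critical-restrict (e , z , e₁ , z′ , e₂ , far) =
      edge-restrict e , ψ z , edge-restrict e₁ , ψ z′ , edge-restrict e₂ ,
      far-restrict (subst₂ (Far G) (sym (φψ z)) (sym (φψ z′)) far)

    valid-extend : ∀ {k} {c : Fin m → Fin k} → Valid g c → Valid G (c ∘ ψ)
    valid-extend valid p q eq = valid _ _ eq ∘ critical-restrict

embedding⇒≅ : ∀ {n} {X G : Graph n} {φ : Fin n → Fin n} → Injective _≡_ _≡_ φ → Induces X G φ → G ≅ X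
embedding⇒≅ {X = X} {G} {φ} inj ind = record
  { bijection = ↔⇒⤖ (mk↔ₛ′ ψ φ (λ i → inj (φψ (φ i))) φψ)
  ; preserves = λ u v → mk⇔ (edge-restrict ind ψ φψ)
      (λ e → subst₂ (Graph._~_ G) (φψ u) (φψ v) (to (edges ind _ _) e))
  }
  where
  ψ : Fin _ → Fin _
  ψ v = proj₁ (injective⇒onto inj ≤-refl v)
  φψ : ∀ v → φ (ψ v) ≡ v
  φψ v = proj₂ (injective⇒onto inj ≤-refl v)

≈⇒≅ : ∀ {n} {X g G : Graph n} {φ : Fin n → Fin n} → Injective _≡_ _≡_ φ → Induces g G φ →
      X ≈ g → G ≅ X
≈⇒≅ {φ = φ} inj ind (listed search) with satisfied search
... | σ , preserves , σ-inj = embedding⇒≅ {φ = φ ∘ lookup σ} (σ-inj _ _ ∘ inj)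
  (induced λ i j → mk⇔ (to (edges ind _ _) ∘ proj₁ (preserves i j)) (proj₂ (preserves i j) ∘ from (edges ind _ _)))

-- The twelve graphs have the required value

DiameterTwo : ∀ {n} → Graph n → Set
DiameterTwo X = Colourable X 1 × ∃[ u ] ∃[ v ] (u ≢ v × ¬ (u ~ v))
  where open Graph X

diameterTwo? : ∀ {n} (X : Graph n) → Dec (DiameterTwo X)
diameterTwo? X = colourable? X 1 ×-dec any? λ u → any? λ v → ¬? (u ≟ᶠ v) ×-dec ¬? (u ~? v)
  where open Graph X

-- Certifies the value two for a connected graph: the colouring bounds it from above, and a far pair
-- defeats one colour. In `DiameterTwo` the colouring says that no edge is critical, and the
-- nonadjacent pair excludes zero.
TwoColours : ∀ {n} → Graph n → Set
TwoColours X = Colourable X 2 × ∃[ u ] ∃[ v ] Far X u v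

twoColours? : ∀ {n} (X : Graph n) → Dec (TwoColours X)
twoColours? X = colourable? X 2 ×-dec any? λ u → any? λ v → far? X u v

HasSpvcMinus3 : ∀ {n} → Graph n → Set
HasSpvcMinus3 {n} G = ∃[ k ] (IsSpvc G k × k + 3 ≡ n)

module Backward {n} {G : Graph n} (connected : Connected G) (a : Fin n) where
  open Graph G

  module _ {m} {X : Graph m} (iso : G ≅ X) where
    open _≅_ iso
    private
      module X = Graph X
      module I = Inverse (⤖⇒↔ bijection)

    order : m ≡ n
    order = sym (↔⇒≡ (⤖⇒↔ bijection))

    pull-edge : ∀ {i j} → i X.~ j → I.from i ~ I.from j
    pull-edge {i} {j} e = from (preserves _ _)
      (subst₂ X._~_ (sym (I.strictlyInverseˡ i)) (sym (I.strictlyInverseˡ j)) e)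

    pulled : Induces X G I.from
    pulled = induced λ i j → mk⇔ pull-edge λ e →
      subst₂ X._~_ (I.strictlyInverseˡ i) (I.strictlyInverseˡ j) (to (preserves _ _) e)

    pushed : Induces G X I.to
    pushed = induced preserves

    pull-far : ∀ {i j} → Far X i j → Far G (I.from i) (I.from j)
    pull-far {i} {j} far = far-restrict pushed
      (subst₂ (Far X) (sym (I.strictlyInverseˡ i)) (sym (I.strictlyInverseˡ j)) far)

    pull-strong : ∀ {k} → Colourable X k → StrongProperWith G k
    pull-strong (c , valid) = valid⇒strong G connected (lookup c ∘ I.to)
      (valid-extend pulled I.to I.strictlyInverseʳ valid) a

    pull-net : ∀ {p t} → Net X p t → Net G (I.from ∘ p) (I.from ∘ t)
    pull-net {p} {t} (p~t , only , apart) =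
      (λ i → pull-edge (p~t i)) ,
      (λ i b e → trans (sym (I.strictlyInverseʳ b)) (cong I.from (only i (I.to b)
        (subst (X._~ I.to b) (I.strictlyInverseˡ (p i)) (to (preserves _ _) e))))) ,
      (λ i j i≢j → pull-edge (proj₁ (apart i j i≢j)) , pull-far (proj₂ (apart i j i≢j)))

  far⇒¬strong₀ : ∀ {u v} → Far G u v → ¬ StrongProperWith G 0
  far⇒¬strong₀ (u≢v , u≁v , _) s = u≁v (strong₀⇒complete G s _ _ u≢v)

  far⇒¬strong₁ : ∀ {u v} → Far G u v → ¬ StrongProperWith G 1
  far⇒¬strong₁ far s = strong₁⇒¬far G s _ _ far

  spvc₀ : ∀ {X : Graph 3} → (∀ u v → u ≢ v → Graph._~_ X u v) → G ≅ X → HasSpvcMinus3 G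
  spvc₀ {X} adjacent iso = 0 , (complete⇒strong G (λ u v u≢v → from (preserves u v)
      (adjacent _ _ (u≢v ∘ I.injective))) , λ _ _ → z≤n) , order iso
    where
    open _≅_ iso
    module I = Function.Bijection bijection

  spvc₁ : ∀ {X : Graph 4} → DiameterTwo X → G ≅ X → HasSpvcMinus3 G
  spvc₁ (c , u , v , u≢v , u≁v) iso =
    1 , (pull-strong iso c , least) , order iso
    where
    open _≅_ iso
    module I = Inverse (⤖⇒↔ bijection)
    least : ∀ k → StrongProperWith G k → 1 ≤ k
    least (suc k) s = s≤s z≤n
    least zero    s = ⊥-elim (u≁v (from (edges (pulled iso) _ _) (strong₀⇒complete G s _ _
      (λ eq → u≢v (trans (sym (I.strictlyInverseˡ u)) (trans (cong I.to eq) (I.strictlyInverseˡ v)))))))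

  spvc₂ : ∀ {X : Graph 5} → TwoColours X → G ≅ X → HasSpvcMinus3 G
  spvc₂ (c , u , v , far) iso =
    2 , (pull-strong iso c , least) , order iso
    where
    least : ∀ k → StrongProperWith G k → 2 ≤ k
    least zero          s = ⊥-elim (far⇒¬strong₀ (pull-far iso far) s)
    least (suc zero)    s = ⊥-elim (far⇒¬strong₁ (pull-far iso far) s)
    least (suc (suc k)) s = s≤s (s≤s z≤n)

  spvc₃ : ∀ {X : Graph 6} {p t} → Colourable X 3 × Net X p t → G ≅ X → HasSpvcMinus3 G
  spvc₃ (c , net) iso =
    3 , (pull-strong iso c , least) , order iso
    where
    far = pull-far iso (proj₂ (proj₂ (proj₂ net) 0F 1F λ ()))
    least : ∀ k → StrongProperWith G k → 3 ≤ k
    least zero                s = ⊥-elim (far⇒¬strong₀ far s)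
    least (suc zero)          s = ⊥-elim (far⇒¬strong₁ far s)
    least (suc (suc zero))    s = ⊥-elim (net⇒¬strong₂ G (pull-net iso net) s)
    least (suc (suc (suc k))) s = s≤s (s≤s (s≤s z≤n))

Twelve : ∀ {n} → Graph n → Set
Twelve G =
      G ≅ complete 3
    ⊎ G ≅ star 3
    ⊎ G ≅ cycle 4
    ⊎ G ≅ attachPendant (complete 3) (# 0)
    ⊎ G ≅ K₄-e
    ⊎ G ≅ path 5
    ⊎ G ≅ subdivide (star 3) (# 0) (# 1)
    ⊎ G ≅ attachPendant (attachPendant (complete 3) (# 0)) (suc (# 1))
    ⊎ G ≅ joinByEdge (complete 3) (# 0) (path 2) (# 0)
    ⊎ G ≅ attachPendant (cycle 4) (# 0)
    ⊎ G ≅ attachPendant K₄-e (# 0)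
    ⊎ G ≅ attachPendant (attachPendant (attachPendant (complete 3) (# 0)) (suc (# 1))) (suc (suc (# 2)))

pendants : Fin 3 → Fin 6
pendants = lookup (0F ∷ 1F ∷ 2F ∷ [])

-- Each attachment shifts the older vertices by one, which brings the triangle to 3, 4, 5; the
-- newest pendant 0 hangs at 5.
triangle : Fin 3 → Fin 6
triangle = lookup (5F ∷ 4F ∷ 3F ∷ [])

net-check : Colourable net 3 × Net net pendants triangle
net-check = toWitness {a? = colourable? net 3 ×-dec net? net pendants triangle} tt

backward : ∀ {n} {G : Graph n} → Connected G → Fin n → Twelve G → HasSpvcMinus3 G
backward connected a =
  Sum.[ spvc₀ (λ _ _ u≢v → u≢v) , Sum.[ one _ , Sum.[ one _ , Sum.[ one _ , Sum.[ one _ ,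
  Sum.[ two _ , Sum.[ two _ , Sum.[ two _ , Sum.[ two _ , Sum.[ two _ , Sum.[ two _ ,
        spvc₃ net-check ] ] ] ] ] ] ] ] ] ] ]
  where
  open Backward connected a
  -- Once `X` is known, `check` is filled in by evaluating the decision procedure.
  one : ∀ X {check : True (diameterTwo? X)} → _ ≅ X → _
  one X {check} = spvc₁ (toWitness {a? = diameterTwo? X} check)
  two : ∀ X {check : True (twoColours? X)} → _ ≅ X → _
  two X {check} = spvc₂ (toWitness {a? = twoColours? X} check)

-- Colours that `f` never takes are punched out of the palette one after another.
compress : ∀ {A : Set} m {N} {d : Fin m → Fin N} → Injective _≡_ _≡_ d →
           (f : A → Fin N) → (∀ a i → d i ≢ f a) →
           Σ[ f′ ∈ (A → Fin (N ∸ m)) ] (∀ a b → f′ a ≡ f′ b → f a ≡ f b)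
compress zero    inj f avoid = f , λ _ _ eq → eq
compress (suc m) {zero}  {d} inj f avoid with () ← d zero
compress (suc m) {suc N} {d} inj f avoid =
  let f′ , f′-inj = compress m {d = λ i → punchOut (d₀≢ i)}
        (λ eq → suc-injective (inj (punchOut-injective (d₀≢ _) (d₀≢ _) eq)))
        (λ a → punchOut (avoid a zero))
        (λ a i eq → avoid a (suc i) (punchOut-injective (d₀≢ i) (avoid a zero) eq))
  in f′ , λ a b eq → punchOut-injective (avoid a zero) (avoid b zero) (f′-inj a b eq)
  where
  d₀≢ : ∀ i → d zero ≢ d (suc i)
  d₀≢ i eq with () ← inj eq

↑ˡ≢↑ʳ : ∀ {k n} (i : Fin k) (j : Fin n) → i ↑ˡ n ≢ k ↑ʳ j
↑ˡ≢↑ʳ (suc i) j eq = ↑ˡ≢↑ʳ i j (suc-injective eq)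

fresh : ∀ {m n} (f : Fin m → Fin n) → m < n → ∃[ v ] (∀ i → f i ≢ v)
fresh {m} {n} f m<n with any? (λ v → all? λ i → ¬? (f i ≟ᶠ v))
... | yes hit  = hit
... | no  none  = ⊥-elim (n≮n m (≤-trans m<n (injective⇒≤ {f = λ v → proj₁ (hit v)}
  λ {u} {v} eq → trans (sym (proj₂ (hit u))) (trans (cong f eq) (proj₂ (hit v))))))
  where
  hit : ∀ v → ∃[ i ] f i ≡ v
  hit v with any? (λ i → f i ≟ᶠ v)
  ... | yes p = p
  ... | no ¬p = ⊥-elim (none (v , λ i eq → ¬p (i , eq)))

-- New vertices come first, in agreement with `Code`.
extend : ∀ {m n} → (Fin m → Fin n) → ∀ j → (Fin j → Fin n) → Fin (j + m) → Fin n
extend f zero    k i       = f i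
extend f (suc j) k zero    = k zero
extend f (suc j) k (suc i) = extend f j (k ∘ suc) i

module _ {m n} (f : Fin m → Fin n) where

  extend-old : ∀ j k a → extend f j k (j ↑ʳ a) ≡ f a
  extend-old zero    k a = refl
  extend-old (suc j) k a = extend-old j (k ∘ suc) a

  extend-new : ∀ j k i → extend f j k (i ↑ˡ m) ≡ k i
  extend-new (suc j) k zero    = refl
  extend-new (suc j) k (suc i) = extend-new j (k ∘ suc) i

  Fresh : ∀ j → (Fin j → Fin n) → Set
  Fresh j k = Injective _≡_ _≡_ (extend f j k)

  fresh-many : Injective _≡_ _≡_ f → ∀ j → j + m ≤ n → ∃[ k ] Fresh j k
  fresh-many inj zero    le = (λ ()) , inj
  fresh-many inj (suc j) le with k , k-fresh ← fresh-many inj j (<⇒≤ le)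
    with v , new ← fresh (extend f j k) le =
    (λ { zero → v ; (suc i) → k i }) ,
    λ { {zero}  {zero}  eq → refl
      ; {zero}  {suc b} eq → ⊥-elim (new b (sym eq))
      ; {suc a} {zero}  eq → ⊥-elim (new a eq)
      ; {suc a} {suc b} eq → cong suc (k-fresh eq) }

-- Induced codes and colourings that save four colours

module _ {n : ℕ} (G : Graph n) where
  open Graph G

  encode : ∀ {m} → (Fin m → Fin n) → Code m
  encode {zero}  φ = tt
  encode {suc m} φ = tabulate (λ i → isYes (φ zero ~? φ (suc i))) , encode (φ ∘ suc)

  encode-edges : ∀ {m} (φ : Fin m → Fin n) i j → T (adj (encode φ) i j) ⇔ (φ i ~ φ j)
  encode-edges φ zero    zero    = mk⇔ (λ ()) (~-irr _)
  encode-edges φ zero    (suc j) = mk⇔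
    (λ t → toWitness (subst T (lookup∘tabulate _ j) t))
    (λ e → subst T (sym (lookup∘tabulate _ j)) (fromWitness e))
  encode-edges φ (suc i) zero    = mk⇔
    (λ t → ~-sym (toWitness (subst T (lookup∘tabulate _ i) t)))
    (λ e → subst T (sym (lookup∘tabulate _ i)) (fromWitness (~-sym e)))
  encode-edges φ (suc i) (suc j) = encode-edges (φ ∘ suc) i j

  encode-induces : ∀ {m} (φ : Fin m → Fin n) → Induces (graph (encode φ)) G φ
  encode-induces φ = induced (encode-edges φ)

  admissible : ∀ {Base Step} (f : Fin 4 → Fin n) → Base (graph (encode f)) →
    (∀ j k → Fresh f (suc j) k → Step j (graph (encode (extend f (suc j) k)))) →
    ∀ j k → Fresh f j k → Admissible Base Step j (encode (extend f j k))
  admissible f base step zero    k new = base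
  admissible f base step (suc j) k new =
    admissible f base step j (k ∘ suc) (λ eq → suc-injective (new eq)) , step j k new

  far-sym : ∀ {u v} → Far G u v → Far G v u
  far-sym (u≢v , u≁v , apart) = u≢v ∘ sym , u≁v ∘ ~-sym , λ w e e′ → apart w (~-sym e′) (~-sym e)

  critical-sym : ∀ {p q} → Critical G p q → Critical G q p
  critical-sym (e , z , e₁ , z′ , e₂ , far) =
    ~-sym e , z′ , ~-sym e₂ , z , ~-sym e₁ , far-sym far

  critical-irr : ∀ {p} → ¬ Critical G p p
  critical-irr (e , _) = ~-irr _ e

  -- Saving four colours refutes the value `n - 3`.
  Economical : Set
  Economical = ∃[ j ] (j + 4 ≤ n × Σ[ c ∈ (Fin n → Fin j) ] Valid G c)

  local-colouring : ∀ {m k} {φ : Fin m → Fin n} (c : Fin m → Fin k) → Injective _≡_ _≡_ φ →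
    (∀ i j → c i ≡ c j → ¬ Critical G (φ i) (φ j)) → k + 4 ≤ m → Economical
  local-colouring {m} {k} {φ} c inj proper saved =
    let c′ , reflects = compress m {d = λ i → k ↑ʳ φ i} (λ eq → inj (↑ʳ-injective k _ _ eq)) colour avoid
    in k + n ∸ m , bound , c′ , λ p q eq → proper′ p q (reflects p q eq)
    where
    colour : Fin n → Fin (k + n)
    colour v with any? (λ i → φ i ≟ᶠ v)
    ... | yes (i , _) = c i ↑ˡ n
    ... | no  _       = k ↑ʳ v
    avoid : ∀ v i → k ↑ʳ φ i ≢ colour v
    avoid v i eq with any? (λ i → φ i ≟ᶠ v)
    ... | yes (j , _) = ↑ˡ≢↑ʳ (c j) (φ i) (sym eq)
    ... | no  ¬p      = ¬p (i , ↑ʳ-injective k _ _ eq)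
    proper′ : ∀ p q → colour p ≡ colour q → ¬ Critical G p q
    proper′ p q eq crit with any? (λ i → φ i ≟ᶠ p) | any? (λ i → φ i ≟ᶠ q)
    ... | yes (i , refl) | yes (j , refl) = proper i j (↑ˡ-injective n _ _ eq) crit
    ... | yes (i , _)    | no  _          = ↑ˡ≢↑ʳ (c i) q eq
    ... | no  _          | yes (j , _)    = ↑ˡ≢↑ʳ (c j) p (sym eq)
    ... | no  _          | no  _ with refl ← ↑ʳ-injective k p q eq = critical-irr crit
    m≤n = injective⇒≤ inj
    bound : k + n ∸ m + 4 ≤ n
    bound = +-cancelˡ-≤ k _ _ (begin
      k + (k + n ∸ m + 4)  ≡⟨ cong (k +_) (+-comm _ 4) ⟩
      k + (4 + (k + n ∸ m)) ≡⟨ sym (+-assoc k 4 _) ⟩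
      k + 4 + (k + n ∸ m)  ≤⟨ +-monoˡ-≤ _ saved ⟩
      m + (k + n ∸ m)      ≡⟨ m+[n∸m]≡n (≤-trans m≤n (m≤n+m n k)) ⟩
      k + n                ∎)
      where open ≤-Reasoning

  Compatible : ∀ {k} → Fin n × Fin k → Fin n × Fin k → Set
  Compatible (u , a) (v , b) = u ≢ v × (a ≡ b → ¬ Critical G u v)

  private
    pairwise : ∀ {k} {xs : List (Fin n × Fin k)} → AllPairs Compatible xs →
               ∀ i j → i ≢ j → Compatible (lookupᴸ xs i) (lookupᴸ xs j)
    pairwise (r ∷ rs) zero    zero    i≢j = ⊥-elim (i≢j refl)
    pairwise (r ∷ rs) zero    (suc j) i≢j = All.lookup r (∈-lookup j)
    pairwise (r ∷ rs) (suc i) zero    i≢j with ne , nc ← All.lookup r (∈-lookup i) =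
      ne ∘ sym , λ eq → nc (sym eq) ∘ critical-sym
    pairwise (r ∷ rs) (suc i) (suc j) i≢j = pairwise rs i j (i≢j ∘ cong suc)

  listed-colouring : ∀ {k} {xs : List (Fin n × Fin k)} → AllPairs Compatible xs →
                     k + 4 ≤ lengthᴸ xs → Economical
  listed-colouring {xs = xs} pairs = local-colouring (proj₂ ∘ lookupᴸ xs) inj proper
    where
    inj : Injective _≡_ _≡_ (proj₁ ∘ lookupᴸ xs)
    inj {i} {j} eq with i ≟ᶠ j
    ... | yes p = p
    ... | no ¬p = ⊥-elim (proj₁ (pairwise pairs i j ¬p) eq)
    proper : ∀ i j → _ → ¬ Critical G _ _
    proper i j eq with i ≟ᶠ j
    ... | yes refl = critical-irr
    ... | no ¬p    = proj₂ (pairwise pairs i j ¬p) eq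

-- Merging colour classes

module _ {n : ℕ} (G : Graph n) where
  open Graph G

  Mergeable : Fin n → Fin n → Set
  Mergeable u v = u ≢ v × ¬ Critical G u v

  mergeable? : ∀ u v → Dec (Mergeable u v)
  mergeable? u v = ¬? (u ≟ᶠ v) ×-dec ¬? (critical? G u v)

  nonadjacent⇒mergeable : ∀ {u v} → u ≢ v → ¬ (u ~ v) → Mergeable u v
  nonadjacent⇒mergeable u≢v u≁v = u≢v , u≁v ∘ proj₁

  mergeable-sym : ∀ {u v} → Mergeable u v → Mergeable v u
  mergeable-sym (ne , nc) = ne ∘ sym , nc ∘ critical-sym G

  private
    same : ∀ {k u v} {a : Fin k} → Mergeable u v → Compatible G (u , a) (v , a)
    same (ne , nc) = ne , λ _ → nc

  -- Each of the two classes of three saves two colours.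
  merge-triples : ∀ {a b c d e f} → Mergeable a b → Mergeable a c → Mergeable b c →
    Mergeable d e → Mergeable d f → Mergeable e f →
    All (λ v → a ≢ v × b ≢ v × c ≢ v) (d ∷ e ∷ f ∷ []) → Economical G
  merge-triples ab ac bc de df ef ((ad , bd , cd) ∷ (ae , be , ce) ∷ (af , bf , cf) ∷ []) =
    listed-colouring G {k = 2}
      {xs = (_ , 0F) ∷ (_ , 0F) ∷ (_ , 0F) ∷ (_ , 1F) ∷ (_ , 1F) ∷ (_ , 1F) ∷ []}
      ((same ab ∷ same ac ∷ (ad , λ ()) ∷ (ae , λ ()) ∷ (af , λ ()) ∷ []) ∷
       (same bc ∷ (bd , λ ()) ∷ (be , λ ()) ∷ (bf , λ ()) ∷ []) ∷
       ((cd , λ ()) ∷ (ce , λ ()) ∷ (cf , λ ()) ∷ []) ∷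
       (same de ∷ same df ∷ []) ∷ (same ef ∷ []) ∷ [] ∷ []) ≤-refl

  -- The triple saves two colours and each pair one.
  merge-triple-pairs : ∀ {a b c p q s t} → Mergeable a b → Mergeable a c → Mergeable b c →
    Mergeable p q → Mergeable s t → All (λ v → p ≢ v × q ≢ v) (s ∷ t ∷ []) →
    All (λ v → a ≢ v × b ≢ v × c ≢ v) (p ∷ q ∷ s ∷ t ∷ []) → Economical G
  merge-triple-pairs ab ac bc pq st ((ps , qs) ∷ (pt , qt) ∷ [])
    ((ap , bp , cp) ∷ (aq , bq , cq) ∷ (as , bs , cs) ∷ (at , bt , ct) ∷ []) =
    listed-colouring G {k = 3}
      {xs = (_ , 0F) ∷ (_ , 0F) ∷ (_ , 0F) ∷ (_ , 1F) ∷ (_ , 1F) ∷ (_ , 2F) ∷ (_ , 2F) ∷ []}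
      ((same ab ∷ same ac ∷ (ap , λ ()) ∷ (aq , λ ()) ∷ (as , λ ()) ∷ (at , λ ()) ∷ []) ∷
       (same bc ∷ (bp , λ ()) ∷ (bq , λ ()) ∷ (bs , λ ()) ∷ (bt , λ ()) ∷ []) ∷
       ((cp , λ ()) ∷ (cq , λ ()) ∷ (cs , λ ()) ∷ (ct , λ ()) ∷ []) ∷
       (same pq ∷ (ps , λ ()) ∷ (pt , λ ()) ∷ []) ∷ ((qs , λ ()) ∷ (qt , λ ()) ∷ []) ∷
       (same st ∷ []) ∷ [] ∷ []) ≤-refl

  -- Four vertices whose complement is a clique of critical edges

  module _ (7≤n : 7 ≤ n) where

    module Clique (x y r c : Fin n)
      (inj : Injective _≡_ _≡_ (lookup (x ∷ y ∷ r ∷ c ∷ [])))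
      (far : Far G x y) (x≁r : ¬ (x ~ r)) (y≁r : ¬ (y ~ r)) (x≁c : ¬ (x ~ c))
      (clique : ∀ u v → (∀ a → lookup (x ∷ y ∷ r ∷ c ∷ []) a ≢ u) →
                        (∀ a → lookup (x ∷ y ∷ r ∷ c ∷ []) a ≢ v) → u ≢ v → Critical G u v)
      where

      O : Fin 4 → Fin n
      O = lookup (x ∷ y ∷ r ∷ c ∷ [])

      Outside : Fin n → Set
      Outside v = ∀ a → O a ≢ v

      -- A witness of a critical edge u v of the clique outside O would be adjacent to v as well.
      witness : ∀ {u v z z′} → Outside v → z ~ u → v ~ z′ → Far G z z′ → ∃[ a ] O a ≡ z
      witness {u} {v} {z} {z′} v-out z~u v~z′ (_ , z≁z′ , apart) with any? (λ a → O a ≟ᶠ z)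
      ... | yes hit  = hit
      ... | no  none  = ⊥-elim (apart v (proj₁ z-v) v~z′)
        where
        z-v : Critical G z v
        z-v = clique z v (λ a eq → none (a , eq)) v-out (λ { refl → z≁z′ v~z′ })

      separated : ∀ {u v} → Outside u → Outside v → u ≢ v →
                  ∃[ a ] (O a ~ u × ∃[ b ] (v ~ O b × Far G (O a) (O b)))
      separated u-out v-out u≢v with clique _ _ u-out v-out u≢v
      ... | u~v , z , z~u , z′ , v~z′ , z-z′
        with witness v-out z~u v~z′ z-z′ | witness u-out (~-sym v~z′) (~-sym z~u) (far-sym G z-z′)
      ... | a , refl | b , refl = a , z~u , b , v~z′ , z-z′

      φ : ∀ j → (Fin j → Fin n) → Fin (j + 4) → Fin n
      φ = extend O

      outside : ∀ j {k} → Fresh O j k → ∀ i → Outside (k i)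
      outside j {k} new i a eq = ↑ˡ≢↑ʳ i a (new
        (trans (extend-new O j k i) (trans (sym eq) (sym (extend-old O j k a)))))

      base : CliqueBase (graph (encode G O))
      base = far-restrict ind far , x≁r ∘ to (edges ind 0F 2F) , y≁r ∘ to (edges ind 1F 2F) , x≁c ∘ to (edges ind 0F 3F)
        where
        ind = encode-induces G O

      step : ∀ j k → Fresh O (suc j) k → CliqueStep j (graph (encode G (φ (suc j) k)))
      step j k new = adjacent , ends , λ i → sep i (separated (outside _ {k} new zero) (outside _ {k} new (suc i)) (k₀≢ i))
        where
        ind = encode-induces G (φ (suc j) k)
        k₀≢ : ∀ i → k zero ≢ k (suc i)
        k₀≢ i eq with () ← new {zero} {suc (i ↑ˡ 4)} (trans eq (sym (extend-new O j (k ∘ suc) i)))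
        adjacent : ∀ i → Graph._~_ (graph (encode G (φ (suc j) k))) zero (suc (i ↑ˡ 4))
        adjacent i = from (edges ind zero (suc (i ↑ˡ 4))) (subst (k zero ~_) (sym (extend-new O j (k ∘ suc) i))
          (proj₁ (clique _ _ (outside _ {k} new zero) (outside _ {k} new (suc i)) (k₀≢ i))))
        ends : NotBothEnds j 0F 1F (graph (encode G (φ (suc j) k)))
        ends e e′ = proj₂ (proj₂ far) (k zero)
          (~-sym (subst (k zero ~_) (extend-old O j (k ∘ suc) 0F) (to (edges ind zero (suc j ↑ʳ 0F)) e)))
          (subst (k zero ~_) (extend-old O j (k ∘ suc) 1F) (to (edges ind zero (suc j ↑ʳ 1F)) e′))
        sep : ∀ i → ∃[ a ] (O a ~ k zero × ∃[ b ] (k (suc i) ~ O b × Far G (O a) (O b))) →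
              Separated (suc j) (graph (encode G (φ (suc j) k))) zero (suc (i ↑ˡ 4))
        sep i (a , e , b , e′ , far-ab) =
          a , from (edges ind (suc j ↑ʳ a) zero) (subst (_~ k zero) (sym (extend-old O j (k ∘ suc) a)) e) ,
          b , from (edges ind (suc (i ↑ˡ 4)) (suc j ↑ʳ b))
                (subst₂ _~_ (sym (extend-new O j (k ∘ suc) i)) (sym (extend-old O j (k ∘ suc) b)) e′) ,
          far-restrict ind (subst₂ (Far G) (sym (extend-old O j (k ∘ suc) a)) (sym (extend-old O j (k ∘ suc) b)) far-ab)

      grown : ∀ j k → Fresh O j k → Admissible CliqueBase CliqueStep j (encode G (φ j k))
      grown = admissible G {CliqueBase} {CliqueStep} O base step

      -- Critical edges are edges, so a proper colouring of the seven vertices serves wherever the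
      -- witnesses lie; three colours on seven vertices save four.
      proper⇒economical : ∀ {k c} → Fresh O 3 k → Proper (graph (encode G (φ 3 k))) {3} c → Economical G
      proper⇒economical {k} {c} new proper = local-colouring G c new
        (λ i j eq → proper i j eq ∘ from (encode-edges G (φ 3 k) i j) ∘ proj₁) ≤-refl

      large : ∀ k → Fresh O 4 k → CliqueOutcome (encode G (φ 3 (k ∘ suc))) → Economical G
      large k new (inj₁ (_ , proper))  = proper⇒economical {k ∘ suc} (suc-injective ∘ new) proper
      -- The fourth clique vertex `k zero` is an extension that the enumeration has excluded.
      large k new (inj₂ (_ , no-step)) = ⊥-elim (no-step _ (step 3 k new))

      small : n ≤ 7 → ∀ k → Fresh O 3 k → CliqueOutcome (encode G (φ 3 k)) → Economical G
      small n≤7 k new (inj₁ (_ , proper))      = proper⇒economical {k} new proper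
      small n≤7 k new (inj₂ ((i , valid) , _)) = 3 , 7≤n , _ ,
        valid-extend {g = graph (encode G (φ 3 k))} {φ = φ 3 k} (encode-induces G (φ 3 k))
          (λ v → proj₁ (onto v)) (λ v → proj₂ (onto v))
          {c = cliqueColouring (lookup validPalette i)} valid
        where
        onto = injective⇒onto new n≤7

      economical : Economical G
      economical with 8 ≤? n
      ... | yes 8≤n = by-size (fresh-many O inj 4 8≤n)
        where
        by-size : ∃[ k ] Fresh O 4 k → Economical G
        by-size (k , new) =
          large k new (cliqueCheck _ (grown 3 (k ∘ suc) (suc-injective ∘ new)))
      ... | no n<8 = by-size (fresh-many O inj 3 7≤n)
        where
        by-size : ∃[ k ] Fresh O 3 k → Economical G
        by-size (k , new) = small (s≤s⁻¹ (≰⇒> n<8)) k new (cliqueCheck _ (grown 3 k new))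

-- Order at least seven, with a vertex adjacent to neither end

module _ {n : ℕ} (G : Graph n) where
  open Graph G

  module _ (7≤n : 7 ≤ n) where

    module Remote {x y r : Fin n} (far : Far G x y) (x≢r : x ≢ r) (y≢r : y ≢ r)
                  (x≁r : ¬ (x ~ r)) (y≁r : ¬ (y ~ r)) where

      Inside : Fin n → Set
      Inside v = x ≢ v × y ≢ v × r ≢ v

      -- Mergeable pairs outside `x`, `y`, `r` are viewed as edges of an auxiliary graph, of which
      -- one is to miss `c`.
      Avoiding : Fin n → Set
      Avoiding c = ∃[ u ] ∃[ v ] (Mergeable G u v × Inside u × Inside v × u ≢ c × v ≢ c)

      inside? : ∀ v → Dec (Inside v)
      inside? v = ¬? (x ≟ᶠ v) ×-dec ¬? (y ≟ᶠ v) ×-dec ¬? (r ≟ᶠ v)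

      avoiding? : ∀ c → Dec (Avoiding c)
      avoiding? c = any? λ u → any? λ v → mergeable? G u v ×-dec inside? u ×-dec inside? v ×-dec
                    ¬? (u ≟ᶠ c) ×-dec ¬? (v ≟ᶠ c)

      x-y : Mergeable G x y
      x-y = nonadjacent⇒mergeable G (proj₁ far) (proj₁ (proj₂ far))
      x-r : Mergeable G x r
      x-r = nonadjacent⇒mergeable G x≢r x≁r
      y-r : Mergeable G y r
      y-r = nonadjacent⇒mergeable G y≢r y≁r

      pairs : ∀ {p q s t} → Mergeable G p q → Inside p → Inside q → Mergeable G s t → Inside s → Inside t →
              p ≢ s → p ≢ t → q ≢ s → q ≢ t → Economical G
      pairs pq p-in q-in st s-in t-in p≢s p≢t q≢s q≢t =
        merge-triple-pairs G x-y x-r y-r pq st ((p≢s , q≢s) ∷ (p≢t , q≢t) ∷ [])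
          (p-in ∷ q-in ∷ s-in ∷ t-in ∷ [])

      triple : ∀ {p q s} → Mergeable G p q → Mergeable G p s → Mergeable G q s →
               Inside p → Inside q → Inside s → Economical G
      triple pq ps qs p-in q-in s-in = merge-triples G x-y x-r y-r pq ps qs (p-in ∷ q-in ∷ s-in ∷ [])

      -- A graph in which no vertex meets all edges has two disjoint edges or a triangle.
      module NoStar (avoid : ∀ c → Inside c → Avoiding c) where

        -- A mergeable pair that avoids the middle vertex `d` is disjoint from one of the two given
        -- pairs or closes the triangle.
        two-edges : ∀ {a d g} → Mergeable G a d → Mergeable G d g → a ≢ g →
                    Inside a → Inside d → Inside g → Economical G
        two-edges {a} {d} {g} ad dg a≢g a-in d-in g-in with avoid d d-in
        ... | h , i , hi , h-in , i-in , h≢d , i≢d with h ≟ᶠ a | i ≟ᶠ a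
        ... | no h≢a   | no i≢a = pairs ad a-in d-in hi h-in i-in (h≢a ∘ sym) (i≢a ∘ sym) (h≢d ∘ sym) (i≢d ∘ sym)
        ... | yes refl | _ with i ≟ᶠ g
        ...   | yes refl = triple ad hi dg a-in d-in g-in
        ...   | no i≢g   = pairs dg d-in g-in hi h-in i-in (h≢d ∘ sym) (i≢d ∘ sym) (a≢g ∘ sym) (i≢g ∘ sym)
        two-edges {a} {d} {g} ad dg a≢g a-in d-in g-in
            | h , i , hi , h-in , i-in , h≢d , i≢d | no h≢a | yes refl with h ≟ᶠ g
        ...   | yes refl = triple ad (mergeable-sym G hi) dg a-in d-in g-in
        ...   | no h≢g   = pairs dg d-in g-in hi h-in i-in (h≢d ∘ sym) (i≢d ∘ sym) (h≢g ∘ sym) (a≢g ∘ sym)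

        economical : Economical G
        -- The choice of `c` is arbitrary: it only yields a first mergeable pair `a d`.
        economical with fresh (lookup (x ∷ y ∷ r ∷ [])) (≤-trans (s≤s (s≤s (s≤s (s≤s z≤n)))) 7≤n)
        ... | c , new with avoid c (new 0F , new 1F , new 2F)
        ... | a , d , ad , a-in , d-in , _ with avoid a a-in
        ... | e , g , eg , e-in , g-in , e≢a , g≢a with d ≟ᶠ e | d ≟ᶠ g
        ... | yes refl | _        = two-edges ad eg (g≢a ∘ sym) a-in d-in g-in
        ... | no _     | yes refl = two-edges ad (mergeable-sym G eg) (e≢a ∘ sym) a-in d-in e-in
        ... | no d≢e   | no d≢g   = pairs ad a-in d-in eg e-in g-in (e≢a ∘ sym) (g≢a ∘ sym) d≢e d≢g

      economical : Economical G
      economical with any? (λ c → inside? c ×-dec ¬? (avoiding? c))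
      ... | no none = NoStar.economical λ c c-in → decidable-stable (avoiding? c) λ ¬a → none (c , c-in , ¬a)
      ... | yes (c , (x≢c , y≢c , r≢c) , ¬avoiding) with x ~? c
      ...   | no x≁c  = Clique.economical G 7≤n x y r c
        (lookup-injective ((proj₁ far ∷ x≢r ∷ x≢c ∷ []) ∷ (y≢r ∷ y≢c ∷ []) ∷ (r≢c ∷ []) ∷ [] ∷ []) _ _)
        far x≁r y≁r x≁c
        λ u v u-out v-out u≢v → decidable-stable (critical? G u v) λ ¬crit → ¬avoiding
          (u , v , (u≢v , ¬crit) , (u-out 0F , u-out 1F , u-out 2F) , (v-out 0F , v-out 1F , v-out 2F) ,
           u-out 3F ∘ sym , v-out 3F ∘ sym)
      -- The far vertices `x` and `y` have no common neighbour, so `c` is not adjacent to `y` and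
      -- their roles are exchanged.
      ...   | yes x~c = Clique.economical G 7≤n y x r c
        (lookup-injective ((proj₁ far ∘ sym ∷ y≢r ∷ y≢c ∷ []) ∷ (x≢r ∷ x≢c ∷ []) ∷ (r≢c ∷ []) ∷ [] ∷ []) _ _)
        (far-sym G far) y≁r x≁r (proj₂ (proj₂ far) c x~c ∘ ~-sym)
        λ u v u-out v-out u≢v → decidable-stable (critical? G u v) λ ¬crit → ¬avoiding
          (u , v , (u≢v , ¬crit) , (u-out 1F , u-out 0F , u-out 2F) , (v-out 1F , v-out 0F , v-out 2F) ,
           u-out 3F ∘ sym , v-out 3F ∘ sym)

    -- Order at least seven, with every other vertex adjacent to an end

    module Covered {x y : Fin n} (far : Far G x y) (cover : ∀ w → x ≢ w → y ≢ w → x ~ w ⊎ y ~ w) where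

      -- If `u a` is critical, its witnesses `z` and `z′` are not both adjacent to `y`, being far
      -- apart. So one is a neighbour of `x`, and it is not adjacent to `a` or `u` respectively.
      mergeable-neighbours : ∀ {u a} → x ~ u → x ~ a → u ≢ a →
                             ∃[ a₁ ] ∃[ a₂ ] (x ~ a₁ × x ~ a₂ × Mergeable G a₁ a₂)
      mergeable-neighbours {u} {a} x~u x~a u≢a with critical? G u a
      ... | no ¬crit = u , a , x~u , x~a , u≢a , ¬crit
      ... | yes (_ , z , z~u , z′ , a~z′ , (_ , z≁z′ , apart))
        with cover z  (λ { refl → apart a x~a a~z′ }) (λ { refl → proj₂ (proj₂ far) u x~u (~-sym z~u) })
           | cover z′ (λ { refl → apart u z~u (~-sym x~u) }) (λ { refl → proj₂ (proj₂ far) a x~a a~z′ })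
      ... | inj₁ x~z | _         = z , a , x~z , x~a ,
        nonadjacent⇒mergeable G (λ { refl → z≁z′ a~z′ }) (λ z~a → apart a z~a a~z′)
      ... | inj₂ _   | inj₁ x~z′ = z′ , u , x~z′ , x~u ,
        nonadjacent⇒mergeable G (λ { refl → z≁z′ z~u }) (λ z′~u → apart u z~u (~-sym z′~u))
      ... | inj₂ y~z | inj₂ y~z′ = ⊥-elim (apart y (~-sym y~z) y~z′)

      module OneNeighbour {v : Fin n} (y~v : y ~ v) (only : ∀ b → y ~ b → b ≡ v) where

        Joint : Fin n → Set
        Joint w = x ~ w × v ~ w

        joint? : ∀ w → Dec (Joint w)
        joint? w = (x ~? w) ×-dec (v ~? w)

        colour : Fin n → Fin 2
        colour w with joint? w
        ... | yes _ = 1F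
        ... | no  _ = 0F

        colour-reflects : ∀ {p q} → colour p ≡ colour q → Joint p → Joint q
        colour-reflects {p} {q} eq jp with joint? p | joint? q
        ... | yes _ | yes jq = jq
        ... | no ¬jp | _     = ⊥-elim (¬jp jp)
        colour-reflects () jp | yes _ | no _

        x≁v : ¬ (x ~ v)
        x≁v x~v = proj₂ (proj₂ far) v x~v (~-sym y~v)

        -- If `z′` is `y`, then `q` is `v`, which is not joint, while `p` is. If `z′` is `v`, then
        -- `q` is joint, while `p` is not, since `z` and `v` have no common neighbour.
        distinguishes : ∀ {z p q z′} → z ~ p → p ~ q → q ~ z′ → Far G z z′ → z′ ≡ y ⊎ z′ ≡ v →
                        colour p ≢ colour q
        distinguishes {z} {p} {q} z~p p~q q~y (_ , z≁y , _) (inj₁ refl) eq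
          with refl ← only q (~-sym q~y)
          with cover p (λ { refl → x≁v p~q }) (λ { refl → z≁y z~p })
        ... | inj₁ x~p = x≁v (proj₁ (colour-reflects eq (x~p , ~-sym p~q)))
        ... | inj₂ y~p with refl ← only p y~p = ~-irr v p~q
        distinguishes {z} {p} {q} z~p p~q q~v (_ , z≁v , apart) (inj₂ refl) eq
          with cover q (λ { refl → x≁v q~v })
                       (λ { refl → z≁v (subst (z ~_) (only p (~-sym p~q)) z~p) })
        ... | inj₁ x~q = apart p z~p (~-sym (proj₂ (colour-reflects (sym eq) (x~q , ~-sym q~v))))
        ... | inj₂ y~q with refl ← only q y~q = ~-irr v q~v

        locate : ∀ w → (w ≡ y ⊎ w ≡ v) ⊎ (x ≡ w ⊎ x ~ w)
        locate w with x ≟ᶠ w | y ≟ᶠ w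
        ... | yes eq | _      = inj₂ (inj₁ eq)
        ... | no _   | yes eq = inj₁ (inj₁ (sym eq))
        ... | no x≢w | no y≢w with cover w x≢w y≢w
        ... | inj₁ x~w = inj₂ (inj₂ x~w)
        ... | inj₂ y~w = inj₁ (inj₂ (only w y~w))

        -- Two vertices of the closed neighbourhood of `x` are never far apart, so one witness is
        -- `y` or `v`.
        colour-valid : Valid G colour
        colour-valid p q eq (p~q , z , z~p , z′ , q~z′ , z-z′@(z≢z′ , z≁z′ , apart))
          with locate z | locate z′
        ... | _        | inj₁ end = distinguishes z~p p~q q~z′ z-z′ end eq
        ... | inj₁ end | _        =
          distinguishes (~-sym q~z′) (~-sym p~q) (~-sym z~p) (far-sym G z-z′) end (sym eq)
        ... | inj₂ (inj₁ refl) | inj₂ (inj₁ refl) = z≢z′ refl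
        ... | inj₂ (inj₁ refl) | inj₂ (inj₂ x~z′) = z≁z′ x~z′
        ... | inj₂ (inj₂ x~z)  | inj₂ (inj₁ refl) = z≁z′ (~-sym x~z)
        ... | inj₂ (inj₂ x~z)  | inj₂ (inj₂ x~z′) = apart x (~-sym x~z) x~z′

        economical : Economical G
        economical = 2 , ≤-trans (n≤1+n 6) 7≤n , colour , colour-valid

    covered⇒economical : ∀ {x u v y} → Far G x y → (∀ w → x ≢ w → y ≢ w → x ~ w ⊎ y ~ w) →
                         x ~ u → y ~ v → Economical G
    covered⇒economical {x} {u} {v} {y} far@(x≢y , x≁y , apart) cover x~u y~v
      with any? (λ a → (x ~? a) ×-dec ¬? (u ≟ᶠ a)) | any? (λ b → (y ~? b) ×-dec ¬? (v ≟ᶠ b))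
    ... | _ | no none = Covered.OneNeighbour.economical far cover y~v
      λ b y~b → decidable-stable (b ≟ᶠ v) λ b≢v → none (b , y~b , b≢v ∘ sym)
    ... | no none | _ = Covered.OneNeighbour.economical (far-sym G far) cover′ x~u
      λ a x~a → decidable-stable (a ≟ᶠ u) λ a≢u → none (a , x~a , a≢u ∘ sym)
      where
      cover′ : ∀ w → y ≢ w → x ≢ w → y ~ w ⊎ x ~ w
      cover′ w y≢w x≢w = Sum.swap (cover w x≢w y≢w)
    ... | yes (a , x~a , u≢a) | yes (b , y~b , v≢b)
      with Covered.mergeable-neighbours far cover x~u x~a u≢a
         | Covered.mergeable-neighbours (far-sym G far) (λ w y≢w x≢w → Sum.swap (cover w x≢w y≢w)) y~v y~b v≢b
    ... | a₁ , a₂ , x~a₁ , x~a₂ , a₁a₂ | b₁ , b₂ , y~b₁ , y~b₂ , b₁b₂ =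
      -- Each end is adjacent to no neighbour of the other and so joins the mergeable pair found
      -- there.
      merge-triples G (y-a x~a₁) (y-a x~a₂) a₁a₂ (x-b y~b₁) (x-b y~b₂) b₁b₂
        ((x≢y ∘ sym , irr x~a₁ , irr x~a₂) ∷ cross y~b₁ ∷ cross y~b₂ ∷ [])
      where
      y-a : ∀ {a} → x ~ a → Mergeable G y a
      y-a x~a = nonadjacent⇒mergeable G (λ { refl → x≁y x~a }) (apart _ x~a ∘ ~-sym)
      x-b : ∀ {b} → y ~ b → Mergeable G x b
      x-b y~b = nonadjacent⇒mergeable G (λ { refl → x≁y (~-sym y~b) }) (λ x~b → apart _ x~b (~-sym y~b))
      irr : ∀ {a} → x ~ a → a ≢ x
      irr x~a refl = ~-irr _ x~a
      cross : ∀ {b} → y ~ b → y ≢ b × a₁ ≢ b × a₂ ≢ b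
      cross y~b = (λ { refl → ~-irr _ y~b }) , (λ { refl → apart _ x~a₁ (~-sym y~b) }) ,
                  (λ { refl → apart _ x~a₂ (~-sym y~b) })

    economical : Economical G
    economical with any? (λ p → any? (critical? G p))
    ... | no none = 1 , ≤-trans (s≤s (s≤s (s≤s (s≤s (s≤s z≤n))))) 7≤n , (λ _ → 0F) ,
                    λ p q _ crit → none (p , q , crit)
    ... | yes (u , v , _ , x , x~u , y , v~y , far)
      with any? (λ r → ¬? (x ≟ᶠ r) ×-dec ¬? (y ≟ᶠ r) ×-dec ¬? (x ~? r) ×-dec ¬? (y ~? r))
    ...   | yes (r , x≢r , y≢r , x≁r , y≁r) = Remote.economical far x≢r y≢r x≁r y≁r
    ...   | no none = covered⇒economical far cover x~u (~-sym v~y)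
      where
      cover : ∀ w → x ≢ w → y ≢ w → x ~ w ⊎ y ~ w
      cover w x≢w y≢w = decidable-stable ((x ~? w) ⊎-dec (y ~? w))
        λ neither → none (w , x≢w , y≢w , neither ∘ inj₁ , neither ∘ inj₂)

-- Orders three to six

module _ {n : ℕ} (G : Graph n) where
  open Graph G

  module _ {x u v y : Fin n} (x~u : x ~ u) (u~v : u ~ v) (v~y : v ~ y) (far : Far G x y) where

    private
      x≢y = proj₁ far
      x≁y = proj₁ (proj₂ far)
      apart = proj₂ (proj₂ far)

    route : Fin 4 → Fin n
    route = lookup (x ∷ u ∷ v ∷ y ∷ [])

    route-injective : Injective _≡_ _≡_ route
    route-injective = lookup-injective
      (((λ { refl → ~-irr _ x~u }) ∷ (λ { refl → x≁y v~y }) ∷ x≢y ∷ []) ∷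
       ((λ { refl → ~-irr _ u~v }) ∷ (λ { refl → x≁y x~u }) ∷ []) ∷
       ((λ { refl → ~-irr _ v~y }) ∷ []) ∷ [] ∷ []) _ _

    route-admissible : ∀ j k → Fresh route j k →
                       Admissible PathBase PathStep j (encode G (extend route j k))
    route-admissible = admissible G {PathBase} {PathStep} route base step
      where
      base : PathBase (graph (encode G route))
      base = let ind = encode-induces G route in
        from (edges ind 0F 1F) x~u , from (edges ind 1F 2F) u~v , from (edges ind 2F 3F) v~y , far-restrict ind far
      step : ∀ j k → Fresh route (suc j) k → PathStep j (graph (encode G (extend route (suc j) k)))
      step j k _ e e′ = apart (k zero)
        (~-sym (subst (k zero ~_) (extend-old route j (k ∘ suc) 0F) (to (edges ind zero (suc j ↑ʳ 0F)) e)))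
        (subst (k zero ~_) (extend-old route j (k ∘ suc) 3F) (to (edges ind zero (suc j ↑ʳ 3F)) e′))
        where
        ind = encode-induces G (extend route (suc j) k)

¬strong₁⇒critical : ∀ {n} {G : Graph n} → Connected G → Fin n → ¬ StrongProperWith G 1 →
                    ∃[ p ] ∃[ q ] Critical G p q
¬strong₁⇒critical {G = G} connected a ¬strong₁ with any? (λ p → any? (critical? G p))
... | yes crit = crit
... | no  none = ⊥-elim (¬strong₁ (valid⇒strong G connected {k = 1} (λ _ → 0F)
                   (λ p q _ crit → none (p , q , crit)) a))

embedded-valid⇒strong : ∀ {m n k} {g : Graph m} {G : Graph n} {φ : Fin m → Fin n} {c : Fin m → Fin k} →
  Connected G → Injective _≡_ _≡_ φ → n ≤ m → Induces g G φ → Valid g c → Fin n → StrongProperWith G k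
embedded-valid⇒strong {G = G} {c = c} connected inj n≤m ind valid =
  valid⇒strong G connected (λ v → c (proj₁ (onto v))) (valid-extend ind _ (λ v → proj₂ (onto v)) valid)
  where
  onto = injective⇒onto inj n≤m

neighbour : ∀ {n} {G : Graph n} → Connected G → ∀ {u v} → u ≢ v → ∃[ w ] Graph._~_ G u w
neighbour connected {u} {v} u≢v with connected u v
... | ε     , _ = ⊥-elim (u≢v refl)
... | e ◅ _ , _ = _ , e

order3 : {G : Graph 3} → StrongProperWith G 0 → G ≅ complete 3
order3 {G} strong = embedding⇒≅ {φ = id} id (induced λ i j → mk⇔ (strong₀⇒complete G strong i j)
  λ { e refl → Graph.~-irr G _ e })

order4 : {G : Graph 4} → ¬ StrongProperWith G 0 → StrongProperWith G 1 →
  G ≅ star 3 ⊎ G ≅ cycle 4 ⊎ G ≅ attachPendant (complete 3) (# 0) ⊎ G ≅ K₄-e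
order4 {G} ¬strong₀ strong₁ =
  Sum.map iso (Sum.map iso (Sum.map iso iso))
    (fourVertexCheck (encode G id) (λ u v → strong₁⇒¬far G strong₁ u v ∘ far-restrict converse)
      λ complete → ¬strong₀ (complete⇒strong G λ u v u≢v → to (edges ind u v) (complete u v u≢v)))
  where
  ind = encode-induces G id
  converse : Induces G (graph (encode G id)) id
  converse = induced λ i j → mk⇔ (from (edges ind i j)) (to (edges ind i j))
  iso : ∀ {X} → X ≈ graph (encode G id) → G ≅ X
  iso = ≈⇒≅ {φ = id} id ind

FiveVertexGraph : Graph 5 → Set
FiveVertexGraph G =
  G ≅ path 5
    ⊎ G ≅ subdivide (star 3) (# 0) (# 1)
    ⊎ G ≅ attachPendant (attachPendant (complete 3) (# 0)) (suc (# 1))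
    ⊎ G ≅ joinByEdge (complete 3) (# 0) (path 2) (# 0)
    ⊎ G ≅ attachPendant (cycle 4) (# 0)
    ⊎ G ≅ attachPendant K₄-e (# 0)

order5 : {G : Graph 5} → Connected G → ∃[ p ] ∃[ q ] Critical G p q → FiveVertexGraph G
order5 {G} connected (u , v , u~v , x , x~u , y , v~y , far) =
  classify (fresh-many O (route-injective G x~u u~v v~y far) 1 ≤-refl)
  where
  O : Fin 4 → Fin 5
  O = route G x~u u~v v~y far
  classify : ∃[ k ] Fresh O 1 k → FiveVertexGraph G
  classify (k , new) =
    Sum.map iso (Sum.map iso (Sum.map iso (Sum.map iso (Sum.map iso iso))))
      (fiveVertexCheck (encode G φ) (route-admissible G x~u u~v v~y far 1 k new) attached)
    where
    φ : Fin 5 → Fin 5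
    φ = extend O 1 k
    iso : ∀ {X} → X ≈ graph (encode G φ) → G ≅ X
    iso = ≈⇒≅ {φ = φ} new (encode-induces G φ)
    k≢x : k 0F ≢ x
    k≢x eq with () ← new {0F} {1F} eq
    -- Connectedness enters here: the fifth vertex has a neighbour.
    attached : ∃[ i ] T (adj (encode G φ) zero i)
    attached = let w , e = neighbour connected k≢x
                   i , eq = injective⇒onto new ≤-refl w
               in i , from (encode-edges G φ 0F i) (subst (Graph._~_ G (k 0F)) (sym eq) e)

order6 : {G : Graph 6} → Connected G → ∃[ p ] ∃[ q ] Critical G p q → ¬ StrongProperWith G 2 → G ≅ net
order6 {G} connected (u , v , u~v , x , x~u , y , v~y , far) ¬strong₂ =
  classify (fresh-many O (route-injective G x~u u~v v~y far) 2 ≤-refl)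
  where
  O : Fin 4 → Fin 6
  O = route G x~u u~v v~y far
  classify : ∃[ k ] Fresh O 2 k → G ≅ net
  classify (k , new) =
    Sum.[ (λ (i , valid) → ⊥-elim (¬strong₂
              (embedded-valid⇒strong {g = graph (encode G φ)} {G} {φ} {c = lookup (lookup pathPalette i)} connected new ≤-refl (encode-induces G φ) valid 0F)))
        , ≈⇒≅ {φ = φ} new (encode-induces G φ) ]
      (sixVertexCheck (encode G φ) (route-admissible G x~u u~v v~y far 2 k new))
    where
    φ : Fin 6 → Fin 6
    φ = extend O 2 k

-- Both directions of the theorem

forward : ∀ {n} {G : Graph n} → Connected G → HasSpvcMinus3 G → Twelve G
forward connected (0 , (strong , _) , refl) = inj₁ (order3 strong)
forward connected (1 , (strong , least) , refl) =
  inj₂ (Sum.map id (Sum.map id (Sum.map id inj₁)) (order4 (λ s → n≮n 0 (least 0 s)) strong))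
forward connected (2 , (_ , least) , refl) =
  inj₂ (inj₂ (inj₂ (inj₂ (inj₂ (Sum.map id (Sum.map id (Sum.map id (Sum.map id (Sum.map id inj₁))))
    (order5 connected (¬strong₁⇒critical connected 0F λ s → n≮n 1 (least 1 s))))))))
forward connected (3 , (_ , least) , refl) =
  inj₂ (inj₂ (inj₂ (inj₂ (inj₂ (inj₂ (inj₂ (inj₂ (inj₂ (inj₂ (inj₂
    (order6 connected (¬strong₁⇒critical connected 0F λ s → n≮n 1 (≤-trans (n≤1+n 2) (least 1 s))) λ s → n≮n 2 (least 2 s))))))))))))
forward {G = G} connected (suc (suc (suc (suc k))) , (_ , least) , refl) =
  -- The least number is `4 + k` and the order `4 + k + 3`, at least seven; but `j` colours suffice
  -- with `j + 4` at most the order.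
  let j , j+4≤n , c , valid = economical G (s≤s (s≤s (s≤s (s≤s (m≤n+m 3 k)))))
  in ⊥-elim (n≮n (4 + k + 3) (≤-trans (≤-reflexive (sym (+-suc (4 + k) 3)))
       (≤-trans (+-monoˡ-≤ 4 (least j (valid⇒strong G connected c valid 0F))) j+4≤n)))

theorem7 : ∀ {n : ℕ} (G : Graph n) → 2 ≤ n → Connected G →
    (∃[ k ] (IsSpvc G k × k + 3 ≡ n))
    ⇔
    ( G ≅ complete 3
    ⊎ G ≅ star 3
    ⊎ G ≅ cycle 4
    ⊎ G ≅ attachPendant (complete 3) (# 0)
    ⊎ G ≅ K₄-e
    ⊎ G ≅ path 5
    ⊎ G ≅ subdivide (star 3) (# 0) (# 1)
    ⊎ G ≅ attachPendant (attachPendant (complete 3) (# 0)) (suc (# 1))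
    ⊎ G ≅ joinByEdge (complete 3) (# 0) (path 2) (# 0)
    ⊎ G ≅ attachPendant (cycle 4) (# 0)
    ⊎ G ≅ attachPendant K₄-e (# 0)
    ⊎ G ≅ attachPendant (attachPendant (attachPendant (complete 3) (# 0)) (suc (# 1))) (suc (suc (# 2)))
    )
theorem7 G 2≤n connected = mk⇔ (forward connected) (backward connected (fromℕ< 2≤n))
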